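{- Let $q=p^2$ with $p>11$ prime, and $n/2\le k\le n-1$. Then $C_k(n,q)$ contains no codeword whose weight lies in the open interval $]\theta_k,(12\theta_k+6)/7[$.
   Context: $\theta_k=(q^{k+1}-1)/(q-1)$. $C_k(n,q)$ is the $p$-ary linear code spanned over $\mathbb{F}_p$ by the rows of the incidence matrix of $k$-dimensional subspaces versus points of $PG(n,q)$; the weight of a codeword is its number of nonzero coordinates. -}

module Defs where

open import Data.Nat using (ℕ; zero; suc; _+_; _*_; _^_; _∸_)
open import Data.Fin using (Fin)
open import Data.Fin.Properties using () renaming (_≟_ to _≟F_)
open import Data.Nat.Divisibility using (_∣?_)
open import Data.Bool using (Bool; true; false; not; _∧_; if_then_else_)
open import Data.List using (List; []; _∷_; [_]; map; concatMap; length; filterᵇ; allFin)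
open import Data.Vec using (Vec; []; _∷_; replicate; zipWith)
open import Data.Product using (Σ; _×_; _,_; ∃)
open import Relation.Nullary using (¬_)
open import Relation.Nullary.Decidable using (⌊_⌋)
open import Relation.Binary.PropositionalEquality using (_≡_; _≢_)
open import Algebra.Structures using (IsCommutativeRing)

record FieldOn (q : ℕ) : Set where
  field
    _+F_ _*F_ : Fin q → Fin q → Fin q
    -F_ : Fin q → Fin q
    0F 1F : Fin q
    isCommutativeRing : IsCommutativeRing _≡_ _+F_ _*F_ -F_ 0F 1F
    0≢1 : 0F ≢ 1F
    inv : Fin q → Fin q
    inv-correct : ∀ x → x ≢ 0F → x *F inv x ≡ 1F

module Geometry {q : ℕ} (F : FieldOn q) where
  open FieldOn F

  Vect : ℕ → Set
  Vect N = Vec (Fin q) N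

  zeroV : ∀ {N} → Vect N
  zeroV = replicate _ 0F

  _+V_ : ∀ {N} → Vect N → Vect N → Vect N
  _+V_ = zipWith _+F_

  _·V_ : ∀ {N} → Fin q → Vect N → Vect N
  a ·V v = Data.Vec.map (a *F_) v

  lincomb : ∀ {m N} → Vec (Fin q) m → Vec (Vect N) m → Vect N
  lincomb [] [] = zeroV
  lincomb (l ∷ ls) (v ∷ vs) = (l ·V v) +V lincomb ls vs

  LinIndep : ∀ {m N} → Vec (Vect N) m → Set
  LinIndep {m} vs = ∀ (ls : Vec (Fin q) m) → lincomb ls vs ≡ zeroV → ls ≡ replicate m 0F

  InSpan : ∀ {m N} → Vect N → Vec (Vect N) m → Set
  InSpan {m} x vs = ∃ λ (ls : Vec (Fin q) m) → lincomb ls vs ≡ x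

  allVects : (N : ℕ) → List (Vect N)
  allVects zero = [ [] ]
  allVects (suc N) = concatMap (λ a → map (a ∷_) (allVects N)) (allFin q)

  -- normalized representative of a projective point: first nonzero coordinate is 1
  isNormalized : ∀ {N} → Vect N → Bool
  isNormalized [] = false
  isNormalized (a ∷ v) = if ⌊ a ≟F 0F ⌋ then isNormalized v else ⌊ a ≟F 1F ⌋

  -- points of PG(n,q) are the normalized nonzero vectors of F^(n+1)
  points : (n : ℕ) → List (Vect (suc n))
  points n = filterᵇ isNormalized (allVects (suc n))

  -- A k-dimensional projective subspace of PG(n,q), given by k+1 linearly
  -- independent spanning vectors of F^(n+1).
  Subspace : (n k : ℕ) → Set
  Subspace n k = Σ (Vec (Vect (suc n)) (suc k)) LinIndep

  -- A formal F_p-combination of incidence vectors of k-spaces: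
  -- list of (coefficient, subspace); coefficients taken in ℕ, reduced mod p.
  Combination : (n k : ℕ) → Set
  Combination n k = List (ℕ × Subspace n k)

  data ValueAt {n k : ℕ} (x : Vect (suc n)) : Combination n k → ℕ → Set where
    v-nil : ValueAt x [] 0
    v-in  : ∀ {a S L r} → InSpan x (Data.Product.proj₁ S) → ValueAt x L r → ValueAt x ((a , S) ∷ L) (a + r)
    v-out : ∀ {a S L r} → ¬ InSpan x (Data.Product.proj₁ S) → ValueAt x L r → ValueAt x ((a , S) ∷ L) r

  -- c : F^(n+1) → ℕ represents (its values mod p on the points of PG(n,q))
  -- the codeword Σ a_i χ_{S_i} of C_k(n,q)
  Represents : (p : ℕ) {n k : ℕ} → (Vect (suc n) → ℕ) → Combination n k → Set
  Represents p {n} c L = ∀ x → isNormalized x ≡ true → ValueAt x L (c x)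

  weight : (p : ℕ) {n : ℕ} → (Vect (suc n) → ℕ) → ℕ
  weight p {n} c = length (filterᵇ (λ x → not ⌊ p ∣? c x ⌋) (points n))

-- θ_k = (q^(k+1) - 1)/(q - 1) = 1 + q + ... + q^k
θ : ℕ → ℕ → ℕ
θ q zero = 1
θ q (suc k) = q ^ suc k + θ q k

{-# OPTIONS --safe #-}
-- Let K be the prime subfield of F = F_{p²}, so that F^(n+1) is a K-space of dimension
-- m = 2(n+1). A codeword extends to a homogeneous function f on it (the weighted sum of the
-- indicators of the underlying vector subspaces), and over K f is a polynomial of degree at
-- most r(p-1), where r = 2(n-k). A codeword of weight w gives N = (q-1)w nonzero vectors x
-- with f(x) ≠ 0, so it is enough that 4 p^r N < 7 p^m forces p^r (N+1) ≤ p^m.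
--
-- If s of the p parallel hyperplanes in some direction meet the support of f, then f is
-- divisible by the p - s linear factors of the others, which lowers the degree on each slice;
-- this gives the Reed-Muller bound for the number of nonzeros. To find hyperplanes that miss
-- most of the support, average: some linear hyperplane contains at most N/p of the N points.
-- * If f(0) = 0, f vanishes on that hyperplane by induction, hence its support meets either
--   none or exactly p - 1 of the parallel hyperplanes, and the latter is too heavy.
-- * If f(0) ≠ 0, the support inside that hyperplane M lies by induction in a codimension two
--   subspace. If the support lies in no hyperplane, then, by homogeneity, it meets two of the
--   hyperplanes through this subspace other than M, and some third direction has slices that
--   are hit in between 2 and p - 1 subslices; these are again too heavy. So the support lies
--   in a hyperplane, r drops by one, and after r steps it lies in a subspace of codimension r.
module Submission where

open import Defs
open import Algebra.Bundles using (CommutativeRing)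
import Algebra.Properties.CommutativeMonoid.Sum as Sum
import Algebra.Properties.Ring as RingProperties
import Algebra.Properties.Semiring.Mult as Mult
import Algebra.Solver.Ring.NaturalCoefficients.Default as NaturalSolver
open import Data.Bool using (Bool; true; false; if_then_else_; not)
open import Data.Empty using (⊥; ⊥-elim)
open import Data.Fin using (Fin; zero; suc; toℕ; punchOut; combine; _↑ˡ_; _↑ʳ_)
import Data.Fin as Fin using (cast; remQuot)
open import Data.Fin.Permutation using (Permutation′; permutation)
import Data.Fin.Properties as Fin
open import Data.List using (List; []; _∷_; length; filter; filterᵇ; allFin; tabulate)
import Data.List as List
open import Data.List.Membership.Propositional using (_∈_; _∉_; lose)
open import Data.List.Membership.Propositional.Properties
  using (∈-map⁻; ∈-map⁺; ∈-filter⁻; ∈-filter⁺; ∈-allFin; ∈-length; ∈-lookup)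
open import Data.List.Properties
  using (length-map; length-tabulate; map-tabulate; filter-accept; filter-reject; filter-notAll)
open import Data.List.Relation.Unary.All using (All; []; _∷_)
import Data.List.Relation.Unary.All as All
import Data.List.Relation.Unary.All.Properties as All
open import Data.List.Relation.Unary.AllPairs using ([]; _∷_)
open import Data.List.Relation.Unary.Any using (here; there)
open import Data.List.Relation.Unary.Unique.Propositional using (Unique)
open import Data.List.Relation.Unary.Unique.Propositional.Properties using (map⁺; filter⁺; allFin⁺)
open import Data.Nat as ℕ using (ℕ; zero; suc; s≤s; z≤n; _^_; _∸_)
open import Data.Nat.Coprimality using (prime⇒coprime; coprime-Bézout)
open import Data.Nat.Divisibility using (_∣_; divides; _∣?_)
open import Data.Nat.DivMod using (_mod_; _%_; _/_; m≡m%n+[m/n]*n; m%n<n)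
open import Data.Nat.GCD using (module Bézout)
open import Data.Nat.ListAction using () renaming (sum to listSum)
open import Data.Nat.Primality using (Prime; prime⇒nonTrivial)
import Data.Nat.Properties as ℕ
open import Data.Nat.Tactic.RingSolver using (solve-∀)
open import Data.Product using (∃; _×_; _,_; proj₁; proj₂)
open import Data.Sum using (inj₁; inj₂)
open import Data.Vec using (Vec; []; _∷_; lookup; tail; replicate)
import Data.Vec as Vec
open import Function using (_∘_; id; case_of_)
open import Function.Definitions using (Injective)
open import Level using (0ℓ)
open import Relation.Binary.Definitions using (tri<; tri≈; tri>)
open import Relation.Binary.PropositionalEquality
open import Relation.Nullary using (¬_; yes; no; Dec; does)
open import Relation.Nullary.Decidable using (⌊_⌋; ¬?; _×-dec_; decidable-stable; dec-true; dec-false; isYes≗does)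
open import Relation.Unary using (Decidable)

-- Finite sums and pigeonhole arguments on `Fin n`

module FiniteSums where

  open import Data.Nat using (_+_; _*_; _≤_; _<_; _≟_; _≤?_)
  open import Data.Nat.Properties hiding (_≟_; _≤?_)
  open import Algebra.Properties.CommutativeSemigroup +-commutativeSemigroup using (x∙yz≈y∙xz)
  private module Σℕ = Sum +-0-commutativeMonoid

  -- A missed value could be punched out of the codomain, leaving an injection of `Fin (suc n)` into
  -- `Fin n`.
  injective⇒surjective : ∀ {n} {f : Fin n → Fin n} → Injective _≡_ _≡_ f → ∀ y → ∃ λ x → f x ≡ y
  injective⇒surjective {suc n} {f} inj y with Fin.any? (λ x → f x Fin.≟ y)
  ... | yes r = r
  ... | no ¬r = ⊥-elim (1+n≰n (Fin.injective⇒≤ {f = λ x → punchOut (miss x)}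
          (λ e → inj (Fin.punchOut-injective (miss _) (miss _) e))))
    where miss : ∀ x → y ≢ f x
          miss x e = ¬r (x , sym e)

  injective⇒permutation : ∀ {n} {f : Fin n → Fin n} → Injective _≡_ _≡_ f → Permutation′ n
  injective⇒permutation {f = f} inj = permutation f f⁻¹ ff⁻¹ (λ x → inj (ff⁻¹ (f x)))
    where
    f⁻¹ = λ y → proj₁ (injective⇒surjective inj y)
    ff⁻¹ = λ y → proj₂ (injective⇒surjective inj y)

  zeros : ∀ {n} → (Fin n → ℕ) → List (Fin n)
  zeros {n} w = filter (λ i → w i ≟ 0) (allFin n)

  abstract
    -- Opaque, so that a sum over the `suc p₁` elements of the prime subfield does not split off its
    -- first term by computation.
    sum : ∀ {n} → (Fin n → ℕ) → ℕ
    sum = Σℕ.sum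

    sum-zero : (f : Fin 0 → ℕ) → sum f ≡ 0
    sum-zero f = refl

    sum-suc : ∀ {n} (f : Fin (suc n) → ℕ) → sum f ≡ f zero + sum (f ∘ suc)
    sum-suc f = refl

    sum-cong : ∀ {n} {f g : Fin n → ℕ} → (∀ i → f i ≡ g i) → sum f ≡ sum g
    sum-cong = Σℕ.sum-cong-≗

    sum-comm : ∀ {m n} (f : Fin m → Fin n → ℕ) → sum (λ i → sum (f i)) ≡ sum (λ j → sum (λ i → f i j))
    sum-comm = Σℕ.∑-comm

    sum-mono : ∀ {n} {f g : Fin n → ℕ} → (∀ i → f i ≤ g i) → sum f ≤ sum g
    sum-mono {zero} h = z≤n
    sum-mono {suc n} h = +-mono-≤ (h zero) (sum-mono (h ∘ suc))

    sum-const : ∀ n c → sum {n} (λ _ → c) ≡ n * c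
    sum-const zero c = refl
    sum-const (suc n) c = cong (c +_) (sum-const n c)

    sum-*ˡ : ∀ {n} c (f : Fin n → ℕ) → sum (λ i → c * f i) ≡ c * sum f
    sum-*ˡ {zero} c f = sym (*-zeroʳ c)
    sum-*ˡ {suc n} c f = trans (cong (c * f zero +_) (sum-*ˡ c (f ∘ suc)))
      (sym (*-distribˡ-+ c (f zero) _))

    sum-≥ : ∀ {n} {f : Fin n → ℕ} M → (∀ i → M ≤ f i) → n * M ≤ sum f
    sum-≥ {n} M h = subst (_≤ _) (sum-const n M) (sum-mono h)

    ≤-sum : ∀ {n} (f : Fin n → ℕ) i → f i ≤ sum f
    ≤-sum f zero = m≤m+n _ _
    ≤-sum f (suc i) = ≤-trans (≤-sum (f ∘ suc) i) (m≤n+m _ (f zero))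

    sum-two : ∀ {n} (f : Fin n → ℕ) i j → i ≢ j → f i + f j ≤ sum f
    sum-two f zero zero i≢j = ⊥-elim (i≢j refl)
    sum-two f zero (suc j) _ = +-monoʳ-≤ (f zero) (≤-sum (f ∘ suc) j)
    sum-two f (suc i) zero _ = subst (_≤ sum f) (+-comm (f zero) _) (+-monoʳ-≤ (f zero) (≤-sum (f ∘ suc) i))
    sum-two f (suc i) (suc j) i≢j =
      ≤-trans (sum-two (f ∘ suc) i j (i≢j ∘ cong suc)) (m≤n+m _ (f zero))

    sum-≤⇒∃ : ∀ {n} (f : Fin (suc n) → ℕ) B → sum f ≤ suc n * B → ∃ λ i → f i ≤ B
    sum-≤⇒∃ {n} f B h with f zero ≤? B
    ... | yes p = zero , p
    ... | no ¬p with n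
    ...   | zero = ⊥-elim (¬p (subst₂ _≤_ (+-identityʳ _) (+-identityʳ _) h))
    ...   | suc m with sum-≤⇒∃ (f ∘ suc) B
                        (+-cancelˡ-≤ B _ _ (≤-trans (+-monoˡ-≤ _ (<⇒≤ (≰⇒> ¬p))) h))
    ...     | i , q = suc i , q

    sum-tabulate : ∀ {n} (g : Fin n → ℕ) → listSum (tabulate g) ≡ sum g
    sum-tabulate {zero} g = refl
    sum-tabulate {suc n} g = cong (g zero +_) (sum-tabulate (g ∘ suc))

    module _ {n : ℕ} (w : Fin n → ℕ) (s M : ℕ) (gap : ∀ i → w i ≢ 0 → M ≤ s * w i) where

      private
        list-gap : ∀ L → length L * M ≤ s * listSum (List.map w L) + length (filter (λ i → w i ≟ 0) L) * M
        list-gap [] = z≤n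
        list-gap (i ∷ L) = case w i ≟ 0 of λ
          { (yes e) → begin
              M + length L * M ≤⟨ +-monoʳ-≤ M (list-gap L) ⟩
              M + (s * a + b * M) ≡⟨ x∙yz≈y∙xz M (s * a) (b * M) ⟩
              s * a + (M + b * M) ≡⟨ cong₂ (λ x y → s * (x + a) + length y * M) (sym e)
                                   (sym (filter-accept (λ i → w i ≟ 0) {xs = L} e)) ⟩
              s * (w i + a) + length (filter (λ i → w i ≟ 0) (i ∷ L)) * M ∎
          ; (no ¬e) → begin
              M + length L * M ≤⟨ +-mono-≤ (gap i ¬e) (list-gap L) ⟩
              s * w i + (s * a + b * M) ≡⟨ sym (+-assoc (s * w i) (s * a) _) ⟩
              s * w i + s * a + b * M ≡⟨ cong₂ (λ x y → x + length y * M) (sym (*-distribˡ-+ s (w i) a))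
                                   (sym (filter-reject (λ i → w i ≟ 0) {xs = L} ¬e)) ⟩
              s * (w i + a) + length (filter (λ i → w i ≟ 0) (i ∷ L)) * M ∎ }
          where
          open ≤-Reasoning
          a = listSum (List.map w L)
          b = length (filter (λ i → w i ≟ 0) L)

      -- Each index pays for one `M`, either through `s * w i` or by being a zero of `w`. So if
      -- nonzero terms are at least `M / s`, the sum is at least `M / s` times their number;
      -- division and subtraction are cleared.
      sum-gap : n * M ≤ s * sum w + length (zeros w) * M
      sum-gap = subst₂ (λ a b → a * M ≤ s * b + length (zeros w) * M) count-all total (list-gap (allFin n))
        where
        count-all : length (allFin n) ≡ n
        count-all = length-tabulate id
        total : listSum (List.map w (allFin n)) ≡ sum w
        total = trans (cong listSum (map-tabulate id w)) (sum-tabulate w)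

    zeros-unique : ∀ {n} (w : Fin n → ℕ) → Unique (zeros w)
    zeros-unique {n} w = filter⁺ (λ i → w i ≟ 0) (allFin⁺ n)

    ∈-zeros : ∀ {n} (w : Fin n → ℕ) {i} → i ∈ zeros w → w i ≡ 0
    ∈-zeros {n} w h = proj₂ (∈-filter⁻ (λ i → w i ≟ 0) {xs = allFin n} h)

    zeros-∈ : ∀ {n} (w : Fin n → ℕ) {i} → w i ≡ 0 → i ∈ zeros w
    zeros-∈ w {i} e = ∈-filter⁺ (λ i → w i ≟ 0) (∈-allFin i) e

    length-zeros : ∀ {n} (w : Fin n → ℕ) i → w i ≢ 0 → length (zeros w) < n
    length-zeros {n} w i h = subst (length (zeros w) <_) (length-tabulate {n = n} id)
      (filter-notAll (λ i → w i ≟ 0) (allFin n) (lose (∈-allFin i) h))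

    sum-injective : ∀ {n} {f : Fin n → Fin n} → Injective _≡_ _≡_ f → ∀ (g : Fin n → ℕ) → sum (g ∘ f) ≡ sum g
    sum-injective inj g = sym (Σℕ.sum-permute g (injective⇒permutation inj))

    sum-++ : ∀ m {n} (g : Fin (m + n) → ℕ) → sum g ≡ sum (λ i → g (i ↑ˡ n)) + sum (λ j → g (m ↑ʳ j))
    sum-++ zero g = refl
    sum-++ (suc m) g = trans (cong (g zero +_) (sum-++ m (g ∘ suc))) (sym (+-assoc (g zero) _ _))

    sum-combine : ∀ m {n} (g : Fin (m * n) → ℕ) → sum g ≡ sum {m} (λ i → sum {n} (λ j → g (combine i j)))
    sum-combine zero g = refl
    sum-combine (suc m) {n} g = trans (sum-++ n g) (cong (sum (λ j → g (j ↑ˡ (m * n))) +_) (sum-combine m (λ x → g (n ↑ʳ x))))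

    module _ {m n q : ℕ} (q≡mn : q ≡ m * n) (f : Fin m → Fin n → Fin q)
             (f-injective : ∀ {i j i′ j′} → f i j ≡ f i′ j′ → i ≡ i′ × j ≡ j′) where

      private
        -- Makes `f` an injective self-map of a finite set, hence a permutation, so that
        -- surjectivity and reindexing become available.
        e : Fin (m * n) → Fin (m * n)
        e x = Fin.cast q≡mn (f (proj₁ (Fin.remQuot n x)) (proj₂ (Fin.remQuot {m} n x)))

        cast-injective : ∀ {k l} (k≡l : k ≡ l) {x y : Fin k} → Fin.cast k≡l x ≡ Fin.cast k≡l y → x ≡ y
        cast-injective refl {x} {y} h = trans (sym (Fin.cast-is-id refl x)) (trans h (Fin.cast-is-id refl y))

        e-injective : Injective _≡_ _≡_ e
        e-injective {x} {y} h with f-injective (cast-injective q≡mn h)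
        ... | a , b = trans (sym (Fin.combine-remQuot {m} n x)) (trans (cong₂ combine a b) (Fin.combine-remQuot {m} n y))

        e-combine : ∀ i j → e (combine i j) ≡ Fin.cast q≡mn (f i j)
        e-combine i j = cong (λ r → Fin.cast q≡mn (f (proj₁ r) (proj₂ r))) (Fin.remQuot-combine i j)

      pairs-surjective : ∀ x → ∃ λ i → ∃ λ j → f i j ≡ x
      pairs-surjective x with injective⇒surjective e-injective (Fin.cast q≡mn x)
      ... | y , h = _ , _ , cast-injective q≡mn h

      sum-pairs : ∀ (g : Fin q → ℕ) → sum (λ i → sum (λ j → g (f i j))) ≡ sum g
      sum-pairs g = begin
        sum (λ i → sum (λ j → g (f i j))) ≡⟨ sum-cong (λ i → sum-cong (λ j → cong g (trans (sym (back (f i j)))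
                                                (cong (Fin.cast (sym q≡mn)) (sym (e-combine i j)))))) ⟩
        sum (λ i → sum (λ j → g′ (e (combine {m} {n} i j)))) ≡⟨ sym (sum-combine m {n} (g′ ∘ e)) ⟩
        sum (g′ ∘ e) ≡⟨ sum-injective e-injective g′ ⟩
        sum g′ ≡⟨ sum-cast q≡mn g ⟩
        sum g ∎
        where
        open ≡-Reasoning
        g′ : Fin (m * n) → ℕ
        g′ = g ∘ Fin.cast (sym q≡mn)
        back : ∀ x → Fin.cast (sym q≡mn) (Fin.cast q≡mn x) ≡ x
        back x = Fin.cast-involutive (sym q≡mn) q≡mn x
        sum-cast : ∀ {k l} (k≡l : k ≡ l) (g : Fin k → ℕ) → sum (g ∘ Fin.cast (sym k≡l)) ≡ sum g
        sum-cast refl g = sum-cong (λ i → cong g (Fin.cast-is-id refl i))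

  unique-lookup : ∀ {A : Set} {xs : List A} → Unique xs → ∀ {i j} → List.lookup xs i ≡ List.lookup xs j → i ≡ j
  unique-lookup (_ ∷ _) {zero} {zero} _ = refl
  unique-lookup (x∉ ∷ _) {zero} {suc j} e = ⊥-elim (All.lookup x∉ (∈-lookup j) e)
  unique-lookup (x∉ ∷ _) {suc i} {zero} e = ⊥-elim (All.lookup x∉ (∈-lookup i) (sym e))
  unique-lookup (_ ∷ u) {suc i} {suc j} e = cong suc (unique-lookup u e)

  unique-length : ∀ {n} {xs : List (Fin n)} → Unique xs → length xs ≤ n
  unique-length u = Fin.injective⇒≤ (unique-lookup u)

  -- Putting `i` and `j` in front of the zeros still gives a list without repetitions.
  length-zeros-two : ∀ {n} (w : Fin n → ℕ) {i j} → i ≢ j → w i ≢ 0 → w j ≢ 0 → 2 + length (zeros w) ≤ n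
  length-zeros-two w {i} {j} i≢j hi hj =
    unique-length ((i≢j ∷ All.tabulate (avoid hi)) ∷ (All.tabulate (avoid hj) ∷ zeros-unique w))
    where
    avoid : ∀ {k} → w k ≢ 0 → ∀ {l} → l ∈ zeros w → k ≢ l
    avoid h l∈ refl = h (∈-zeros w l∈)

  third : ∀ {n} (i j : Fin (3 + n)) → ∃ λ k → k ≢ i × k ≢ j
  third zero zero = suc zero , (λ ()) , (λ ())
  third zero (suc zero) = suc (suc zero) , (λ ()) , (λ ())
  third zero (suc (suc _)) = suc zero , (λ ()) , (λ ())
  third (suc zero) zero = suc (suc zero) , (λ ()) , (λ ())
  third (suc (suc _)) zero = suc zero , (λ ()) , (λ ())
  third (suc _) (suc _) = zero , (λ ()) , (λ ())

  avoid-two : ∀ {n} → 3 ≤ n → (i j : Fin n) → ∃ λ k → k ≢ i × k ≢ j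
  avoid-two (s≤s (s≤s (s≤s _))) = third

  abstract
    -- The sum is `h i + (n - 1) * y`; the extra `y` on the left avoids the subtraction.
    sum-except : ∀ {n} (h : Fin n → ℕ) i y → (∀ j → j ≢ i → h j ≡ y) → sum h + y ≡ h i + n * y
    sum-except {suc n} h zero y e = begin
      sum h + y ≡⟨ cong (_+ y) (sum-suc h) ⟩
      h zero + sum (h ∘ suc) + y ≡⟨ cong (λ s → h zero + s + y) (trans (sum-cong (λ j → e (suc j) (λ ()))) (sum-const n y)) ⟩
      h zero + n * y + y ≡⟨ trans (+-assoc (h zero) _ y) (cong (h zero +_) (+-comm _ y)) ⟩
      h zero + (y + n * y) ∎
      where open ≡-Reasoning
    sum-except {suc n} h (suc i) y e = begin
      sum h + y ≡⟨ cong (_+ y) (sum-suc h) ⟩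
      h zero + sum (h ∘ suc) + y ≡⟨ +-assoc (h zero) _ y ⟩
      h zero + (sum (h ∘ suc) + y) ≡⟨ cong₂ _+_ (e zero (λ ())) (sum-except (h ∘ suc) i y (λ j j≢i → e (suc j) (j≢i ∘ Fin.suc-injective))) ⟩
      y + (h (suc i) + n * y) ≡⟨ x∙yz≈y∙xz y (h (suc i)) (n * y) ⟩
      h (suc i) + (y + n * y) ∎
      where open ≡-Reasoning

    -- Split `h` into its restrictions to `i` and to `j`; each is summed by `sum-except` with value
    -- 0 elsewhere.
    sum-supported : ∀ {n} (h : Fin n → ℕ) i j → i ≢ j → (∀ k → k ≢ i → k ≢ j → h k ≡ 0) → sum h ≡ h i + h j
    sum-supported {n} h i j i≢j e = begin
      sum h ≡⟨ sum-cong split ⟩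
      sum (λ k → at i k + at j k) ≡⟨ Σℕ.∑-distrib-+ (at i) (at j) ⟩
      sum (at i) + sum (at j) ≡⟨ cong₂ _+_ (sum-at i) (sum-at j) ⟩
      h i + h j ∎
      where
      open ≡-Reasoning
      at : Fin n → Fin n → ℕ
      at a k with k Fin.≟ a
      ... | yes _ = h k
      ... | no _ = 0
      at-other : ∀ a k → k ≢ a → at a k ≡ 0
      at-other a k k≢a with k Fin.≟ a
      ... | yes k≡a = ⊥-elim (k≢a k≡a)
      ... | no _ = refl
      at-self : ∀ a → at a a ≡ h a
      at-self a with a Fin.≟ a
      ... | yes _ = refl
      ... | no a≢a = ⊥-elim (a≢a refl)
      sum-at : ∀ a → sum (at a) ≡ h a
      sum-at a = begin
        sum (at a) ≡⟨ sym (+-identityʳ _) ⟩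
        sum (at a) + 0 ≡⟨ sum-except (at a) a 0 (at-other a) ⟩
        at a a + n * 0 ≡⟨ cong₂ _+_ (at-self a) (*-zeroʳ n) ⟩
        h a + 0 ≡⟨ +-identityʳ _ ⟩
        h a ∎
      split : ∀ k → h k ≡ at i k + at j k
      split k with k Fin.≟ i | k Fin.≟ j
      ... | yes refl | yes refl = ⊥-elim (i≢j refl)
      ... | yes _ | no _ = sym (+-identityʳ _)
      ... | no _ | yes _ = refl
      ... | no k≢i | no k≢j = e k k≢i k≢j

open FiniteSums

-- Arithmetic of the finite field

module FieldProperties {q : ℕ} (𝔽 : FieldOn q) where
  open FieldOn 𝔽 public using (0≢1; inv; inv-correct)

  commutativeRing : CommutativeRing 0ℓ 0ℓ
  commutativeRing = record { isCommutativeRing = FieldOn.isCommutativeRing 𝔽 }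

  open CommutativeRing commutativeRing public
    using (_+_; _*_; -_; 0#; 1#; +-assoc; +-comm; +-identityˡ; +-identityʳ; -‿inverseˡ; -‿inverseʳ;
           *-assoc; *-comm; *-identityˡ; *-identityʳ; zeroˡ; zeroʳ; distribˡ; distribʳ;
           commutativeSemiring; semiring; ring; +-commutativeMonoid)
  open RingProperties ring public using (+-cancelˡ; +-cancelʳ; -‿distribˡ-*)
  open NaturalSolver commutativeSemiring public using (solve; _:+_; _:*_; _:=_)
  open Mult semiring public using () renaming (_×_ to _×ℕ_; ×-homo-+ to ×ℕ-homo-+; ×1-homo-* to ×ℕ1-homo-*)

  _≟F_ : (x y : Fin q) → Dec (x ≡ y)
  _≟F_ = Fin._≟_

  x*y≡0 : ∀ {x y} → x * y ≡ 0# → x ≢ 0# → y ≡ 0#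
  x*y≡0 {x} {y} e x≢0 = begin
    y ≡⟨ sym (*-identityˡ y) ⟩
    1# * y ≡⟨ cong (_* y) (sym (trans (*-comm (inv x) x) (inv-correct x x≢0))) ⟩
    inv x * x * y ≡⟨ *-assoc _ _ _ ⟩
    inv x * (x * y) ≡⟨ cong (inv x *_) e ⟩
    inv x * 0# ≡⟨ zeroʳ _ ⟩
    0# ∎
    where open ≡-Reasoning

  *-≢0 : ∀ {x y} → x ≢ 0# → y ≢ 0# → x * y ≢ 0#
  *-≢0 x≢0 y≢0 e = y≢0 (x*y≡0 e x≢0)

  *-cancelˡ : ∀ x {y z} → x ≢ 0# → x * y ≡ x * z → y ≡ z
  *-cancelˡ x {y} {z} x≢0 e = trans (sym (undo y)) (trans (cong (inv x *_) e) (undo z))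
    where
    undo : ∀ y → inv x * (x * y) ≡ y
    undo y = trans (sym (*-assoc _ _ _))
      (trans (cong (_* y) (trans (*-comm _ _) (inv-correct x x≢0))) (*-identityˡ y))

  infixl 6 _-_
  _-_ : Fin q → Fin q → Fin q
  x - y = x + (- y)

  y+[x-y]≡x : ∀ x y → y + (x - y) ≡ x
  y+[x-y]≡x x y = begin
    y + (x + - y) ≡⟨ cong (y +_) (+-comm x (- y)) ⟩
    y + (- y + x) ≡⟨ sym (+-assoc y (- y) x) ⟩
    y + - y + x ≡⟨ cong (_+ x) (-‿inverseʳ y) ⟩
    0# + x ≡⟨ +-identityˡ x ⟩
    x ∎
    where open ≡-Reasoning

  x-y≡0⇒x≡y : ∀ {x y} → x - y ≡ 0# → x ≡ y
  x-y≡0⇒x≡y {x} {y} e = trans (sym (y+[x-y]≡x x y)) (trans (cong (y +_) e) (+-identityʳ y))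

  private module ΣF = Sum +-commutativeMonoid

  -- Translation by 1 permutes the field, so Σ x = Σ (x + 1) = Σ x + q · 1.
  q×1≡0 : q ×ℕ 1# ≡ 0#
  q×1≡0 = +-cancelˡ (ΣF.sum id) _ _ (begin
    ΣF.sum id + q ×ℕ 1# ≡⟨ cong (ΣF.sum id +_) (sym (sum-ones q)) ⟩
    ΣF.sum {q} id + ΣF.sum {q} (λ _ → 1#) ≡⟨ sym (ΣF.∑-distrib-+ {q} id (λ _ → 1#)) ⟩
    ΣF.sum {q} (λ x → x + 1#) ≡⟨ sym (ΣF.sum-permute id π) ⟩
    ΣF.sum {q} id ≡⟨ sym (+-identityʳ _) ⟩
    ΣF.sum {q} id + 0# ∎)
    where
    open ≡-Reasoning
    sum-ones : ∀ n → ΣF.sum {n} (λ _ → 1#) ≡ n ×ℕ 1#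
    sum-ones zero = refl
    sum-ones (suc n) = cong (1# +_) (sum-ones n)
    π = injective⇒permutation {f = _+ 1#} (λ {x} {y} → +-cancelʳ 1# x y)

-- Lets a bound with subtracted terms be checked by a ring identity: `D` collects what would be
-- subtracted.
≤-complement : ∀ {A B C} D → A ℕ.+ D ≡ B → B ℕ.≤ C ℕ.+ D → A ℕ.≤ C
≤-complement {A} {B} {C} D e le = ℕ.+-cancelʳ-≤ D A C (subst (ℕ._≤ C ℕ.+ D) (sym e) le)

private
  -- With `p = z + c′ + e` slices, `z` of them empty, this is `(p - z)(z + c′) = c′ p + z e`,
  -- scaled.
  fewZeros : ∀ z c′ e P → c′ ℕ.* ((z ℕ.+ c′ ℕ.+ e) ℕ.* P) ℕ.+ (z ℕ.* e ℕ.* P ℕ.+ z ℕ.* ((z ℕ.+ c′) ℕ.* P)) ≡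
    (z ℕ.+ c′ ℕ.+ e) ℕ.* ((z ℕ.+ c′) ℕ.* P)
  fewZeros = solve-∀

  -- With `p = z + y + 1`, this is `(p - z)(u + 2) = (u + y + 2) + (y u + y)`, scaled.
  manyZeros : ∀ z u y p P → (u ℕ.+ y ℕ.+ 2) ℕ.* (p ℕ.* P) ℕ.+
      ((y ℕ.* u ℕ.+ y) ℕ.* (p ℕ.* P) ℕ.+ z ℕ.* (p ℕ.* ((u ℕ.+ 2) ℕ.* P))) ≡
    (z ℕ.+ suc y) ℕ.* (p ℕ.* ((u ℕ.+ 2) ℕ.* P))
  manyZeros = solve-∀

-- The prime subfield K and coordinates of the field over it

module PrimeSubfield (p₁ : ℕ) (p-prime : Prime (suc p₁)) {q : ℕ} (q≡pp : q ≡ suc p₁ ℕ.* suc p₁)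
                     (𝔽 : FieldOn q) where
  open FieldProperties 𝔽 public

  p : ℕ
  p = suc p₁

  K : Set
  K = Fin p

  -- The multiple `q · 1 = 0` factors as `(p · 1)(p · 1)`, and a field has no zero divisors.
  p×1≡0 : p ×ℕ 1# ≡ 0#
  p×1≡0 with (p ×ℕ 1#) ≟F 0#
  ... | yes e = e
  ... | no ne = x*y≡0 (trans (sym (×ℕ1-homo-* p p)) (trans (cong (_×ℕ 1#) (sym q≡pp)) q×1≡0)) ne

  p∣⇒×1≡0 : ∀ {m} → p ∣ m → m ×ℕ 1# ≡ 0#
  p∣⇒×1≡0 {m} (divides k refl) = trans (×ℕ1-homo-* k p) (trans (cong (k ×ℕ 1# *_) p×1≡0) (zeroʳ _))

  %-×1 : ∀ m → (m % p) ×ℕ 1# ≡ m ×ℕ 1#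
  %-×1 m = sym (begin
    m ×ℕ 1# ≡⟨ cong (_×ℕ 1#) (m≡m%n+[m/n]*n m p) ⟩
    (m % p ℕ.+ m / p ℕ.* p) ×ℕ 1# ≡⟨ ×ℕ-homo-+ 1# (m % p) (m / p ℕ.* p) ⟩
    (m % p) ×ℕ 1# + (m / p ℕ.* p) ×ℕ 1# ≡⟨ cong ((m % p) ×ℕ 1# +_) (p∣⇒×1≡0 (divides (m / p) refl)) ⟩
    (m % p) ×ℕ 1# + 0# ≡⟨ +-identityʳ _ ⟩
    (m % p) ×ℕ 1# ∎)
    where open ≡-Reasoning

  -- By Bézout some multiples of `m` and `p` differ by one, so `m · 1 = 0` would force `1 = 0`.
  <p⇒×1≢0 : ∀ {m} → 0 ℕ.< m → m ℕ.< p → m ×ℕ 1# ≢ 0#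
  <p⇒×1≢0 {m} 0<m m<p m×1≡0 = case coprime-Bézout (prime⇒coprime p-prime ⦃ ℕ.>-nonZero 0<m ⦄ m<p) of λ
    { (Bézout.+- x y e) → 1≢ (y ℕ.* m) (trans (×ℕ1-homo-* y m) (trans (cong (y ×ℕ 1# *_) m×1≡0) (zeroʳ _)))
        (trans (cong (_×ℕ 1#) e) (p∣⇒×1≡0 (divides x refl)))
    ; (Bézout.-+ x y e) → 1≢ (x ℕ.* p) (p∣⇒×1≡0 (divides x refl))
        (trans (cong (_×ℕ 1#) e) (trans (×ℕ1-homo-* y m) (trans (cong (y ×ℕ 1# *_) m×1≡0) (zeroʳ _)))) }
    where
    1≢ : ∀ a → a ×ℕ 1# ≡ 0# → (1 ℕ.+ a) ×ℕ 1# ≢ 0#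
    1≢ a a≡0 e = 0≢1 (sym (trans (sym (+-identityʳ 1#)) (trans (cong (1# +_) (sym a≡0)) e)))

  ×1≡0⇒p∣ : ∀ {m} → m ×ℕ 1# ≡ 0# → p ∣ m
  ×1≡0⇒p∣ {m} e with m % p ℕ.≟ 0
  ... | yes r≡0 = divides (m / p) (trans (m≡m%n+[m/n]*n m p) (cong (ℕ._+ m / p ℕ.* p) r≡0))
  ... | no r≢0 = ⊥-elim (<p⇒×1≢0 (ℕ.n≢0⇒n>0 r≢0) (m%n<n m p) (trans (%-×1 m) e))

  infixl 6 _⊕_
  infixl 7 _⊗_

  abstract
    ι : K → Fin q
    ι i = toℕ i ×ℕ 1#

    _⊕_ _⊗_ : K → K → K
    i ⊕ j = (toℕ i ℕ.+ toℕ j) mod p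
    i ⊗ j = (toℕ i ℕ.* toℕ j) mod p

    ι-toℕ : ∀ i → ι i ≡ toℕ i ×ℕ 1#
    ι-toℕ i = refl

    ι-zero : ι zero ≡ 0#
    ι-zero = refl

    one : K
    one = 1 mod p

    private
      ι-mod : ∀ m → ι (m mod p) ≡ m ×ℕ 1#
      ι-mod m = trans (cong (_×ℕ 1#) (Fin.toℕ-fromℕ< (m%n<n m p))) (%-×1 m)

    ι-⊕ : ∀ i j → ι (i ⊕ j) ≡ ι i + ι j
    ι-⊕ i j = trans (ι-mod (toℕ i ℕ.+ toℕ j)) (×ℕ-homo-+ 1# (toℕ i) (toℕ j))

    ι-⊗ : ∀ i j → ι (i ⊗ j) ≡ ι i * ι j
    ι-⊗ i j = trans (ι-mod (toℕ i ℕ.* toℕ j)) (×ℕ1-homo-* (toℕ i) (toℕ j))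

    ι-one : ι one ≡ 1#
    ι-one = trans (ι-mod 1) (+-identityʳ 1#)

  ι-≢0 : ∀ {i} → i ≢ zero → ι i ≢ 0#
  ι-≢0 {zero} h = ⊥-elim (h refl)
  ι-≢0 {suc i} _ e = <p⇒×1≢0 (s≤s z≤n) (Fin.toℕ<n (suc i)) (trans (sym (ι-toℕ (suc i))) e)

  private
    ×1-< : ∀ {a b} → a ℕ.< b → b ℕ.< p → a ×ℕ 1# ≢ b ×ℕ 1#
    ×1-< {a} {b} a<b b<p e = <p⇒×1≢0 (ℕ.m<n⇒0<n∸m a<b) (ℕ.≤-<-trans (ℕ.m∸n≤m b a) b<p)
      (+-cancelˡ (a ×ℕ 1#) _ _ (trans (sym (×ℕ-homo-+ 1# a (b ℕ.∸ a)))
        (trans (cong (_×ℕ 1#) (ℕ.m+[n∸m]≡n (ℕ.<⇒≤ a<b))) (trans (sym e) (sym (+-identityʳ _))))))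

  -- Otherwise the difference of the two representatives, strictly between 0 and `p`, would vanish
  -- in the field. The ring laws of `_⊕_` and `_⊗_` are pulled back along this injection.
  ι-injective : ∀ {i j} → ι i ≡ ι j → i ≡ j
  ι-injective {i} {j} e with trans (sym (ι-toℕ i)) (trans e (ι-toℕ j)) | ℕ.<-cmp (toℕ i) (toℕ j)
  ... | e′ | tri< lt _ _ = ⊥-elim (×1-< lt (Fin.toℕ<n j) e′)
  ... | e′ | tri≈ _ eq _ = Fin.toℕ-injective eq
  ... | e′ | tri> _ _ gt = ⊥-elim (×1-< gt (Fin.toℕ<n i) (sym e′))

  ⊕-injective : ∀ c {i j} → c ⊕ i ≡ c ⊕ j → i ≡ j
  ⊕-injective c {i} {j} e = ι-injective (+-cancelˡ (ι c) _ _ (trans (sym (ι-⊕ c i)) (trans (cong ι e) (ι-⊕ c j))))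

  ⊗-injective : ∀ {c} → c ≢ zero → ∀ {i j} → c ⊗ i ≡ c ⊗ j → i ≡ j
  ⊗-injective {c} c≢0 {i} {j} e = ι-injective
    (*-cancelˡ (ι c) (ι-≢0 c≢0) (trans (sym (ι-⊗ c i)) (trans (cong ι e) (ι-⊗ c j))))

  ⊕-solve : ∀ c b → ∃ λ i → c ⊕ i ≡ b
  ⊕-solve c = injective⇒surjective (⊕-injective c)

  ⊗-solve : ∀ {c} → c ≢ zero → ∀ b → ∃ λ i → c ⊗ i ≡ b
  ⊗-solve c≢0 = injective⇒surjective (⊗-injective c≢0)

  ⊗-zeroʳ : ∀ i → i ⊗ zero ≡ zero
  ⊗-zeroʳ i = ι-injective (trans (ι-⊗ i zero) (trans (cong (ι i *_) ι-zero) (trans (zeroʳ _) (sym ι-zero))))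

  ⊗-zeroˡ : ∀ i → zero ⊗ i ≡ zero
  ⊗-zeroˡ i = ι-injective (trans (ι-⊗ zero i) (trans (cong (_* ι i) ι-zero) (trans (zeroˡ _) (sym ι-zero))))

  ⊗-identityʳ : ∀ i → i ⊗ one ≡ i
  ⊗-identityʳ i = ι-injective (trans (ι-⊗ i one) (trans (cong (ι i *_) ι-one) (trans (*-comm _ _) (*-identityˡ _))))

  ⊕-identityˡ : ∀ i → zero ⊕ i ≡ i
  ⊕-identityˡ i = ι-injective (trans (ι-⊕ zero i) (trans (cong (_+ ι i) ι-zero) (+-identityˡ _)))

  ⊕-identityʳ : ∀ i → i ⊕ zero ≡ i
  ⊕-identityʳ i = ι-injective (trans (ι-⊕ i zero) (trans (cong (ι i +_) ι-zero) (+-identityʳ _)))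

  ⊗-comm : ∀ i j → i ⊗ j ≡ j ⊗ i
  ⊗-comm i j = ι-injective (trans (ι-⊗ i j) (trans (*-comm _ _) (sym (ι-⊗ j i))))

  ⊗-assoc : ∀ i j k → i ⊗ j ⊗ k ≡ i ⊗ (j ⊗ k)
  ⊗-assoc i j k = ι-injective (begin
    ι (i ⊗ j ⊗ k) ≡⟨ trans (ι-⊗ _ _) (cong (_* ι k) (ι-⊗ i j)) ⟩
    ι i * ι j * ι k ≡⟨ *-assoc _ _ _ ⟩
    ι i * (ι j * ι k) ≡⟨ sym (trans (ι-⊗ _ _) (cong (ι i *_) (ι-⊗ j k))) ⟩
    ι (i ⊗ (j ⊗ k)) ∎)
    where open ≡-Reasoning

  ⊗-distribˡ-⊕ : ∀ i j k → i ⊗ (j ⊕ k) ≡ i ⊗ j ⊕ i ⊗ k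
  ⊗-distribˡ-⊕ i j k = ι-injective (begin
    ι (i ⊗ (j ⊕ k)) ≡⟨ trans (ι-⊗ _ _) (cong (ι i *_) (ι-⊕ j k)) ⟩
    ι i * (ι j + ι k) ≡⟨ distribˡ _ _ _ ⟩
    ι i * ι j + ι i * ι k ≡⟨ sym (trans (ι-⊕ _ _) (cong₂ _+_ (ι-⊗ i j) (ι-⊗ i k))) ⟩
    ι (i ⊗ j ⊕ i ⊗ k) ∎)
    where open ≡-Reasoning

  1<p : 1 ℕ.< p
  1<p = ℕ.nonTrivial⇒n>1 p ⦃ prime⇒nonTrivial p-prime ⦄

  private
    p<q : p ℕ.< q
    p<q = subst (p ℕ.<_) (sym q≡pp) (subst (ℕ._< p ℕ.* p) (ℕ.*-identityʳ p) (ℕ.*-monoʳ-< p 1<p))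

    -- If every field element came from K, choosing preimages would inject `q` elements into `p`.
    ω-exists : ∃ λ ω → ∀ i → ι i ≢ ω
    ω-exists with Fin.any? (λ x → ¬? (Fin.any? (λ i → ι i Fin.≟ x)))
    ... | yes (ω , h) = ω , λ i e → h (i , e)
    ... | no h = ⊥-elim (ℕ.<⇒≱ p<q (Fin.injective⇒≤ {f = λ x → proj₁ (pre x)}
            (λ {x} {y} e → trans (sym (proj₂ (pre x))) (trans (cong ι e) (proj₂ (pre y))))))
      where
      pre : ∀ x → ∃ λ i → ι i ≡ x
      pre x = decidable-stable (Fin.any? (λ i → ι i Fin.≟ x)) (λ ne → h (x , ne))

  ω : Fin q
  ω = proj₁ ω-exists

  pair : K → K → Fin q
  pair i j = ι i + ι j * ω

  -- Two expansions of one element whose `ω`-coefficients differ by `d ≠ 0` would put `ω` into K, as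
  -- the quotient `k` of the difference of the constant terms by `d`.
  pair-injective : ∀ {i j i′ j′} → pair i j ≡ pair i′ j′ → i ≡ i′ × j ≡ j′
  pair-injective {i} {j} {i′} {j′} e with ⊕-solve j j′ | ⊕-solve i′ i
  ... | d , refl | d′ , refl with d Fin.≟ zero
  ...   | yes refl = ι-injective (+-cancelʳ (ι j * ω) _ _
            (trans e (cong (λ k → ι i′ + ι k * ω) (⊕-identityʳ j)))) , sym (⊕-identityʳ j)
  ...   | no d≢0 with ⊗-solve d≢0 d′
  ...     | k , refl = ⊥-elim (proj₂ ω-exists k (*-cancelˡ (ι d) (ι-≢0 d≢0) (trans (sym (ι-⊗ d k)) dk≡dω)))
    where
    open ≡-Reasoning
    dk≡dω : ι (d ⊗ k) ≡ ι d * ω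
    dk≡dω = +-cancelˡ (ι i′ + ι j * ω) _ _ (begin
      ι i′ + ι j * ω + ι (d ⊗ k) ≡⟨ solve 3 (λ a b c → a :+ b :+ c := a :+ c :+ b) refl (ι i′) (ι j * ω) (ι (d ⊗ k)) ⟩
      ι i′ + ι (d ⊗ k) + ι j * ω ≡⟨ cong (_+ ι j * ω) (sym (ι-⊕ i′ (d ⊗ k))) ⟩
      ι (i′ ⊕ d ⊗ k) + ι j * ω ≡⟨ e ⟩
      ι i′ + ι (j ⊕ d) * ω ≡⟨ cong (λ y → ι i′ + y * ω) (ι-⊕ j d) ⟩
      ι i′ + (ι j + ι d) * ω ≡⟨ solve 4 (λ a b c w → a :+ (b :+ c) :* w := a :+ b :* w :+ c :* w) refl (ι i′) (ι j) (ι d) ω ⟩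
      ι i′ + ι j * ω + ι d * ω ∎)

  pair-surjective : ∀ x → ∃ λ i → ∃ λ j → pair i j ≡ x
  pair-surjective = pairs-surjective q≡pp pair pair-injective

  sum-pair : ∀ (g : Fin q → ℕ) → sum (λ i → sum (λ j → g (pair i j))) ≡ sum g
  sum-pair = sum-pairs q≡pp pair pair-injective

  pair≡0 : ∀ {i j} → pair i j ≡ 0# → i ≡ zero × j ≡ zero
  pair≡0 e = pair-injective (trans e (sym pair-zero))
    where
    pair-zero : pair zero zero ≡ 0#
    pair-zero = trans (cong₂ (λ a b → a + b * ω) ι-zero ι-zero) (trans (cong (0# +_) (zeroˡ ω)) (+-identityˡ 0#))

  -- Sums and support counts over K-spaces

  V : ℕ → Set
  V m = Vec K m

  S : ∀ m → (V m → ℕ) → ℕ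
  S zero w = w []
  S (suc m) w = sum (λ t → S m (λ x → w (t ∷ x)))

  S-cong : ∀ m {v w : V m → ℕ} → (∀ x → v x ≡ w x) → S m v ≡ S m w
  S-cong zero h = h []
  S-cong (suc m) h = sum-cong (λ t → S-cong m (λ x → h (t ∷ x)))

  S-mono : ∀ m {v w : V m → ℕ} → (∀ x → v x ℕ.≤ w x) → S m v ℕ.≤ S m w
  S-mono zero h = h []
  S-mono (suc m) h = sum-mono (λ t → S-mono m (λ x → h (t ∷ x)))

  S-const : ∀ m c → S m (λ _ → c) ≡ p ^ m ℕ.* c
  S-const zero c = sym (ℕ.*-identityˡ c)
  S-const (suc m) c = trans (sum-cong (λ t → S-const m c))
    (trans (sum-const p _) (sym (ℕ.*-assoc p (p ^ m) c)))

  S-*ˡ : ∀ m c (w : V m → ℕ) → S m (λ x → c ℕ.* w x) ≡ c ℕ.* S m w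
  S-*ˡ zero c w = refl
  S-*ˡ (suc m) c w = trans (sum-cong (λ t → S-*ˡ m c _)) (sum-*ˡ c (λ t → S m (λ x → w (t ∷ x))))

  S-sum : ∀ m {n} (w : Fin n → V m → ℕ) → S m (λ x → sum (λ t → w t x)) ≡ sum (λ t → S m (w t))
  S-sum zero w = refl
  S-sum (suc m) {n} w = trans (sum-cong (λ s → S-sum m (λ t x → w t (s ∷ x))))
    (sum-comm {p} {n} (λ s t → S m (λ x → w t (s ∷ x))))

  ≤-S : ∀ m (w : V m → ℕ) x → w x ℕ.≤ S m w
  ≤-S zero w [] = ℕ.≤-refl
  ≤-S (suc m) w (t ∷ x) = ℕ.≤-trans (≤-S m (λ x → w (t ∷ x)) x) (≤-sum (λ t → S m (λ x → w (t ∷ x))) t)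

  S≢0 : ∀ m (w : V m → ℕ) → S m w ≢ 0 → ∃ λ x → w x ≢ 0
  S≢0 zero w h = [] , h
  S≢0 (suc m) w h with Fin.any? (λ t → ¬? (S m (λ x → w (t ∷ x)) ℕ.≟ 0))
  ... | yes (t , ht) with S≢0 m (λ x → w (t ∷ x)) ht
  ...   | x , hx = t ∷ x , hx
  S≢0 (suc m) w h | no ¬∃ = ⊥-elim (h (trans (sum-cong (λ t → decidable-stable (_ ℕ.≟ 0) (λ ne → ¬∃ (t , ne))))
    (trans (sum-const p 0) (ℕ.*-zeroʳ p))))

  S≡0 : ∀ m (w : V m → ℕ) → S m w ≡ 0 → ∀ x → w x ≡ 0
  S≡0 m w e x = ℕ.n≤0⇒n≡0 (ℕ.≤-trans (≤-S m w x) (ℕ.≤-reflexive e))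

  supp : Fin q → ℕ
  supp y = if does (y ≟F 0#) then 0 else 1

  supp-0 : ∀ {y} → y ≡ 0# → supp y ≡ 0
  supp-0 {y} e = cong (if_then 0 else 1) (dec-true (y ≟F 0#) e)

  supp-≢0 : ∀ {y} → y ≢ 0# → supp y ≡ 1
  supp-≢0 {y} h = cong (if_then 0 else 1) (dec-false (y ≟F 0#) h)

  supp≡0 : ∀ {y} → supp y ≡ 0 → y ≡ 0#
  supp≡0 {y} e = decidable-stable (y ≟F 0#) (λ h → case trans (sym e) (supp-≢0 h) of λ ())

  count : ∀ {m} → (V m → Fin q) → ℕ
  count {m} f = S m (λ x → supp (f x))

  count≡0 : ∀ {m} (f : V m → Fin q) → count f ≡ 0 → ∀ x → f x ≡ 0#
  count≡0 {m} f e x = supp≡0 (S≡0 m _ e x)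

  count≢0 : ∀ {m} (f : V m → Fin q) x → f x ≢ 0# → count f ≢ 0
  count≢0 f x h e = h (count≡0 f e x)

  -- Polynomial functions on a K-space

  data Affine {m : ℕ} (f : V m → Fin q) : Set where
    const : ∀ c → (∀ x → f x ≡ c) → Affine f
    coord : ∀ i c → (∀ x → f x ≡ c * ι (lookup x i)) → Affine f
    add   : ∀ {g h} → Affine g → Affine h → (∀ x → f x ≡ g x + h x) → Affine f

  -- Deg n f: f is given by a polynomial of degree strictly less than n in the K-coordinates.
  data Deg {m : ℕ} : ℕ → (V m → Fin q) → Set where
    zero  : ∀ {n f} → (∀ x → f x ≡ 0#) → Deg n f
    const : ∀ {n f} c → (∀ x → f x ≡ c) → Deg (suc n) f
    mul   : ∀ {n f l g} → Affine l → Deg n g → (∀ x → f x ≡ l x * g x) → Deg (suc n) f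
    add   : ∀ {n f g h} → Deg n g → Deg n h → (∀ x → f x ≡ g x + h x) → Deg n f

  -- This is what the pointwise equation in each constructor of `Affine` and `Deg` is for: it takes
  -- the place of function extensionality.
  Affine-resp : ∀ {m} {f g : V m → Fin q} → (∀ x → f x ≡ g x) → Affine g → Affine f
  Affine-resp e (const c h) = const c (λ x → trans (e x) (h x))
  Affine-resp e (coord i c h) = coord i c (λ x → trans (e x) (h x))
  Affine-resp e (add a b h) = add a b (λ x → trans (e x) (h x))

  Deg-resp : ∀ {m n} {f g : V m → Fin q} → (∀ x → f x ≡ g x) → Deg n g → Deg n f
  Deg-resp e (zero h) = zero (λ x → trans (e x) (h x))
  Deg-resp e (const c h) = const c (λ x → trans (e x) (h x))
  Deg-resp e (mul a d h) = mul a d (λ x → trans (e x) (h x))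
  Deg-resp e (add a b h) = add a b (λ x → trans (e x) (h x))

  Affine-scale : ∀ {m} {f : V m → Fin q} a → Affine f → Affine (λ x → a * f x)
  Affine-scale a (const c h) = const (a * c) (λ x → cong (a *_) (h x))
  Affine-scale a (coord i c h) = coord i (a * c) (λ x → trans (cong (a *_) (h x)) (sym (*-assoc a c _)))
  Affine-scale a (add u v h) = add (Affine-scale a u) (Affine-scale a v)
    (λ x → trans (cong (a *_) (h x)) (distribˡ a _ _))

  Deg-scale : ∀ {m n} {f : V m → Fin q} a → Deg n f → Deg n (λ x → a * f x)
  Deg-scale a (zero h) = zero (λ x → trans (cong (a *_) (h x)) (zeroʳ a))
  Deg-scale a (const c h) = const (a * c) (λ x → cong (a *_) (h x))
  Deg-scale a (mul l d h) = mul (Affine-scale a l) d (λ x → trans (cong (a *_) (h x)) (sym (*-assoc a _ _)))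
  Deg-scale a (add u v h) = add (Deg-scale a u) (Deg-scale a v)
    (λ x → trans (cong (a *_) (h x)) (distribˡ a _ _))

  Deg-mono : ∀ {m n k} {f : V m → Fin q} → n ℕ.≤ k → Deg n f → Deg k f
  Deg-mono le (zero h) = zero h
  Deg-mono (s≤s le) (const c h) = const c h
  Deg-mono (s≤s le) (mul l d h) = mul l (Deg-mono le d) h
  Deg-mono le (add u v h) = add (Deg-mono le u) (Deg-mono le v) h

  Deg-0 : ∀ {m} {f : V m → Fin q} → Deg 0 f → ∀ x → f x ≡ 0#
  Deg-0 (zero h) x = h x
  Deg-0 (add u v h) x = trans (h x) (trans (cong₂ _+_ (Deg-0 u x) (Deg-0 v x)) (+-identityˡ 0#))

  AffineMap : ∀ {m k} → (V m → V k) → Set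
  AffineMap φ = ∀ i → Affine (λ x → ι (lookup (φ x) i))

  Affine-∘ : ∀ {m k} {φ : V m → V k} → AffineMap φ → ∀ {f} → Affine f → Affine (f ∘ φ)
  Affine-∘ a (const c h) = const c (λ x → h _)
  Affine-∘ a (coord i c h) = Affine-resp (λ x → h _) (Affine-scale c (a i))
  Affine-∘ a (add u v h) = add (Affine-∘ a u) (Affine-∘ a v) (λ x → h _)

  Deg-∘ : ∀ {m k n} {φ : V m → V k} → AffineMap φ → ∀ {f} → Deg n f → Deg n (f ∘ φ)
  Deg-∘ a (zero h) = zero (λ x → h _)
  Deg-∘ a (const c h) = const c (λ x → h _)
  Deg-∘ a (mul l d h) = mul (Affine-∘ a l) (Deg-∘ a d) (λ x → h _)
  Deg-∘ a (add u v h) = add (Deg-∘ a u) (Deg-∘ a v) (λ x → h _)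

  coordinate : ∀ {m} (i : Fin m) → Affine (λ x → ι (lookup x i))
  coordinate i = coord i 1# (λ x → sym (*-identityˡ _))

  slice-affine : ∀ {m} t → AffineMap {m} (t ∷_)
  slice-affine t zero = const (ι t) (λ _ → refl)
  slice-affine t (suc i) = coordinate i

  restrict-affine : ∀ {m} t → AffineMap {suc m} (λ x → t ∷ tail x)
  restrict-affine t zero = const (ι t) (λ _ → refl)
  restrict-affine t (suc i) = Affine-resp (λ { (_ ∷ x) → refl }) (coordinate (suc i))

  private
    -- The slope in the first coordinate is a constant, to which only `coord zero` contributes.
    affine-difference : ∀ {m} t₀ {f : V (suc m) → Fin q} → Affine f → ∃ λ a →
      ∀ t x → f (t ∷ x) ≡ f (t₀ ∷ x) + (ι t - ι t₀) * a
    affine-difference t₀ (const c h) = 0# , λ t x →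
      trans (h _) (sym (trans (cong₂ _+_ (h _) (zeroʳ _)) (+-identityʳ c)))
    affine-difference t₀ (coord zero c h) = c , λ t x → begin
        _ ≡⟨ h _ ⟩
        c * ι t ≡⟨ cong (c *_) (sym (y+[x-y]≡x (ι t) (ι t₀))) ⟩
        c * (ι t₀ + (ι t - ι t₀)) ≡⟨ solve 3 (λ c a d → c :* (a :+ d) := c :* a :+ d :* c) refl c (ι t₀) (ι t - ι t₀) ⟩
        c * ι t₀ + (ι t - ι t₀) * c ≡⟨ cong (_+ (ι t - ι t₀) * c) (sym (h _)) ⟩
        _ ∎
      where open ≡-Reasoning
    affine-difference t₀ (coord (suc i) c h) = 0# , λ t x →
      trans (h _) (sym (trans (cong₂ _+_ (h _) (zeroʳ _)) (+-identityʳ _)))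
    affine-difference t₀ (add u v h) with affine-difference t₀ u | affine-difference t₀ v
    ... | a , ha | b , hb = a + b , λ t x → trans (h _) (trans (cong₂ _+_ (ha t x) (hb t x))
      (trans (solve 5 (λ f g d a b → f :+ d :* a :+ (g :+ d :* b) := f :+ g :+ d :* (a :+ b)) refl _ _ (ι t - ι t₀) a b)
        (cong (_+ (ι t - ι t₀) * (a + b)) (sym (h _)))))

  -- Division of `f - f(t₀, ·)` by `t - t₀`, which lowers the degree by one. For a product this is
  -- the Leibniz rule with the affine factor frozen at `t₀` in one of the two terms.
  difference : ∀ {m n} t₀ {f : V (suc m) → Fin q} → Deg n f → ∃ λ h → Deg (ℕ.pred n) h ×
    (∀ t x → f (t ∷ x) ≡ f (t₀ ∷ x) + (ι t - ι t₀) * h (t ∷ x))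
  difference t₀ (zero e) = (λ _ → 0#) , zero (λ _ → refl) , λ t x →
    trans (e _) (sym (trans (cong₂ _+_ (e _) (zeroʳ _)) (+-identityʳ 0#)))
  difference t₀ (const c e) = (λ _ → 0#) , zero (λ _ → refl) , λ t x →
    trans (e _) (sym (trans (cong₂ _+_ (e _) (zeroʳ _)) (+-identityʳ c)))
  difference t₀ (add u v e) with difference t₀ u | difference t₀ v
  ... | a , da , ha | b , db , hb = (λ x → a x + b x) , add da db (λ _ → refl) , λ t x →
    trans (e _) (trans (cong₂ _+_ (ha t x) (hb t x))
      (trans (solve 5 (λ f g d a b → f :+ d :* a :+ (g :+ d :* b) := f :+ g :+ d :* (a :+ b)) refl _ _ (ι t - ι t₀) (a (t ∷ x)) (b (t ∷ x)))
        (cong (_+ (ι t - ι t₀) * (a (t ∷ x) + b (t ∷ x))) (sym (e _)))))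
  difference {n = suc n} t₀ (mul {l = l} {g = g} la dg e) with affine-difference t₀ la | difference t₀ dg
  ... | a , ha | b , db , hb =
    (λ x → a * g x + l (t₀ ∷ tail x) * b x)
    , add (Deg-scale a dg) (first n db) (λ _ → refl)
    , λ t x → trans (e _) (trans (trans (cong (_* g (t ∷ x)) (ha t x)) (expand t x)) (cong (_+ _) (sym (e _))))
    where
    first : ∀ n → Deg (ℕ.pred n) b → Deg n (λ x → l (t₀ ∷ tail x) * b x)
    -- The predecessor truncates here: `b` has degree below 0 and is therefore zero.
    first zero d = zero (λ x → trans (cong (_ *_) (Deg-0 d x)) (zeroʳ _))
    first (suc n) d = mul (Affine-∘ (restrict-affine t₀) la) d (λ _ → refl)
    expand : ∀ t x → (l (t₀ ∷ x) + (ι t - ι t₀) * a) * g (t ∷ x) ≡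
      l (t₀ ∷ x) * g (t₀ ∷ x) + (ι t - ι t₀) * (a * g (t ∷ x) + l (t₀ ∷ x) * b (t ∷ x))
    expand t x = begin
      (L + d * a) * G ≡⟨ solve 4 (λ L d a G → (L :+ d :* a) :* G := L :* G :+ d :* (a :* G)) refl L d a G ⟩
      L * G + d * (a * G) ≡⟨ cong (λ y → L * y + d * (a * G)) (hb t x) ⟩
      L * (G₀ + d * B) + d * (a * G) ≡⟨ solve 5 (λ L d aG G₀ B → L :* (G₀ :+ d :* B) :+ d :* aG := L :* G₀ :+ d :* (aG :+ L :* B)) refl L d (a * G) G₀ B ⟩
      L * G₀ + d * (a * G + L * B) ∎
      where
      open ≡-Reasoning
      L = l (t₀ ∷ x)
      d = ι t - ι t₀
      G = g (t ∷ x)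
      G₀ = g (t₀ ∷ x)
      B = b (t ∷ x)

  ∏roots : List K → K → Fin q
  ∏roots [] t = 1#
  ∏roots (z ∷ L) t = (ι t - ι z) * ∏roots L t

  -- Divide out one root at a time: away from `z` the factor `t - z` is nonzero, so the quotient
  -- inherits the remaining vanishing slices.
  factor : ∀ {m n} (L : List K) → Unique L → {f : V (suc m) → Fin q} → Deg n f →
    (∀ {t} → t ∈ L → ∀ x → f (t ∷ x) ≡ 0#) →
    ∃ λ g → Deg (n ∸ length L) g × (∀ t x → f (t ∷ x) ≡ ∏roots L t * g (t ∷ x))
  factor [] _ {f} d _ = f , d , λ t x → sym (*-identityˡ _)
  factor {n = n} (z ∷ L) (z∉L ∷ uniq) {f} d vanish with difference z d
  ... | h , dh , eh with factor L uniq dh (λ {t} t∈L x →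
          x*y≡0 (trans (sym (divided t x)) (vanish (there t∈L) x))
            (λ e → All.lookup z∉L t∈L (sym (ι-injective (x-y≡0⇒x≡y e)))))
    where
    divided : ∀ t x → f (t ∷ x) ≡ (ι t - ι z) * h (t ∷ x)
    divided t x = trans (eh t x) (trans (cong (_+ _) (vanish (here refl) x)) (+-identityˡ _))
  ...   | g , dg , eg = g , subst (λ k → Deg k g) (pred-∸ n (length L)) dg , λ t x →
    trans (trans (eh t x) (trans (cong (_+ _) (vanish (here refl) x)) (+-identityˡ _)))
      (trans (cong ((ι t - ι z) *_) (eg t x)) (sym (*-assoc _ _ _)))
    where
    pred-∸ : ∀ n l → ℕ.pred n ∸ l ≡ n ∸ suc l
    pred-∸ zero l = ℕ.0∸n≡0 l
    pred-∸ (suc n) l = refl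

  -- Slices and the Reed-Muller bound

  sliceCount : ∀ {m} → (V (suc m) → Fin q) → K → ℕ
  sliceCount f t = count (λ x → f (t ∷ x))

  -- On a single slice the product of roots is a constant, so the slice has the degree of the
  -- cofactor.
  slice-Deg-vanishing : ∀ {m n} {f : V (suc m) → Fin q} (L : List K) → Unique L → Deg n f →
    (∀ {t} → t ∈ L → ∀ x → f (t ∷ x) ≡ 0#) → ∀ t → Deg (n ∸ length L) (λ x → f (t ∷ x))
  slice-Deg-vanishing L u d vanish t with factor L u d vanish
  ... | g , dg , eg = Deg-resp (eg t) (Deg-scale _ (Deg-∘ (slice-affine t) dg))

  slice-Deg : ∀ {m n} {f : V (suc m) → Fin q} → Deg n f → ∀ t →
    Deg (n ∸ length (zeros (sliceCount f))) (λ x → f (t ∷ x))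
  slice-Deg {f = f} d = slice-Deg-vanishing (zeros (sliceCount f)) (zeros-unique (sliceCount f)) d
    (λ t∈Z x → count≡0 (λ x → f (_ ∷ x)) (∈-zeros (sliceCount f) t∈Z) x)

  nonzero-slice : ∀ {m} (f : V (suc m) → Fin q) → count f ≢ 0 → ∃ λ t → sliceCount f t ≢ 0
  nonzero-slice {m} f h with S≢0 (suc m) (λ x → supp (f x)) h
  ... | t ∷ x , hx = t , count≢0 (λ x → f (t ∷ x)) x (λ e → hx (supp-0 e))

  zeros<p : ∀ {m} (f : V (suc m) → Fin q) → count f ≢ 0 → length (zeros (sliceCount f)) ℕ.< p
  zeros<p f h with nonzero-slice f h
  ... | t , ht = length-zeros (sliceCount f) t ht

  -- The Reed-Muller bound (p - b) p^(m-a-1) for degree a(p-1) + b, with c = b + 1, c′ = p - b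
  -- and denominators cleared.
  minWeight : ∀ m {n} {f : V m → Fin q} → Deg n f → count f ≢ 0 → ∀ a c c′ →
    n ℕ.≤ a ℕ.* p₁ ℕ.+ c → 1 ℕ.≤ c → 1 ℕ.≤ c′ → c ℕ.+ c′ ≡ suc p →
    c′ ℕ.* p ^ m ℕ.≤ p ^ suc a ℕ.* count f
  minWeight zero {f = f} _ f≢0 a c c′ _ 1≤c _ c+c′ = begin
    c′ ℕ.* 1 ≤⟨ ℕ.*-mono-≤ c′≤p (ℕ.n≢0⇒n>0 f≢0) ⟩
    p ℕ.* count f ≤⟨ ℕ.*-monoˡ-≤ (count f) p≤p^ ⟩
    p ^ suc a ℕ.* count f ∎
    where
    open ℕ.≤-Reasoning
    c′≤p : c′ ℕ.≤ p
    c′≤p = ℕ.+-cancelˡ-≤ 1 c′ p (subst (1 ℕ.+ c′ ℕ.≤_) c+c′ (ℕ.+-monoˡ-≤ c′ 1≤c))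
    p≤p^ : p ℕ.≤ p ^ suc a
    p≤p^ = subst (ℕ._≤ p ^ suc a) (ℕ.*-identityʳ p) (ℕ.*-monoʳ-≤ p (ℕ.m^n>0 p a))
  minWeight (suc m) {n} {f} d f≢0 a c c′ n≤ 1≤c 1≤c′ c+c′ with length (zeros (sliceCount f)) ℕ.<? c
  -- Fewer than `c` empty slices: `a` stays and `c` drops to `c - z`, so each nonempty slice obeys
  -- the bound with `z + c′` in place of `c′`.
  ... | yes z<c = few (c ∸ suc z) (sym (ℕ.m+[n∸m]≡n z<c))
    where
    z = length (zeros (sliceCount f))
    M = (z ℕ.+ c′) ℕ.* p ^ m
    few : ∀ e → c ≡ suc z ℕ.+ e → c′ ℕ.* p ^ suc m ℕ.≤ p ^ suc a ℕ.* count f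
    few e refl = ≤-complement (z ℕ.* e ℕ.* p ^ m ℕ.+ z ℕ.* M)
        (trans (cong (λ y → c′ ℕ.* (y ℕ.* p ^ m) ℕ.+ (z ℕ.* e ℕ.* p ^ m ℕ.+ z ℕ.* M)) (sym p≡))
          (trans (fewZeros z c′ e (p ^ m)) (cong (ℕ._* M) p≡)))
        (ℕ.≤-trans (sum-gap (sliceCount f) (p ^ suc a) M gap)
          (ℕ.+-monoʳ-≤ (p ^ suc a ℕ.* count f) (ℕ.m≤n+m (z ℕ.* M) _)))
      where
      rearrange : ∀ z c′ e → z ℕ.+ c′ ℕ.+ e ≡ z ℕ.+ e ℕ.+ c′
      rearrange = solve-∀
      p≡ : z ℕ.+ c′ ℕ.+ e ≡ p
      p≡ = trans (rearrange z c′ e) (ℕ.suc-injective c+c′)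
      regroup : ∀ A z e → A ℕ.+ (suc z ℕ.+ e) ≡ z ℕ.+ (A ℕ.+ suc e)
      regroup = solve-∀
      regroup′ : ∀ z c′ e → suc e ℕ.+ (z ℕ.+ c′) ≡ suc z ℕ.+ e ℕ.+ c′
      regroup′ = solve-∀
      gap : ∀ t → sliceCount f t ≢ 0 → M ℕ.≤ p ^ suc a ℕ.* sliceCount f t
      gap t ht = minWeight m (slice-Deg d t) ht a (suc e) (z ℕ.+ c′)
        (ℕ.m≤n+o⇒m∸n≤o n z (subst (n ℕ.≤_) (regroup (a ℕ.* p₁) z e) n≤))
        (s≤s z≤n) (ℕ.≤-trans 1≤c′ (ℕ.m≤n+m c′ z)) (trans (regroup′ z c′ e) c+c′)
  -- At least `c` empty slices: the drop in degree uses up one of the `a` blocks of size `p - 1` and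
  -- leaves the remainder `p - 1 + c - z`.
  ... | no z≮c = go a n≤
    where
    z = length (zeros (sliceCount f))
    go : ∀ a → n ℕ.≤ a ℕ.* p₁ ℕ.+ c → c′ ℕ.* p ^ suc m ℕ.≤ p ^ suc a ℕ.* count f
    -- With no block left, `n ≤ c ≤ z` makes the degree of every slice drop below 0.
    go zero n≤ with nonzero-slice f f≢0
    ... | t , ht = ⊥-elim (ht (trans (S-cong m (λ x → supp-0 (Deg-0 d₀ x))) (trans (S-const m 0) (ℕ.*-zeroʳ (p ^ m)))))
      where
      d₀ : Deg 0 (λ x → f (t ∷ x))
      d₀ = Deg-mono (ℕ.≤-reflexive (ℕ.m≤n⇒m∸n≡0 (ℕ.≤-trans n≤ (ℕ.≮⇒≥ z≮c)))) (slice-Deg d t)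
    go (suc a₁) n≤ =
      many (z ∸ c) (p ∸ suc z) (sym (ℕ.m+[n∸m]≡n (ℕ.≮⇒≥ z≮c))) (trans (ℕ.+-suc z _) (ℕ.m+[n∸m]≡n (zeros<p f f≢0)))
      where
      many : ∀ u y → z ≡ c ℕ.+ u → z ℕ.+ suc y ≡ p → c′ ℕ.* p ^ suc m ℕ.≤ p ^ suc (suc a₁) ℕ.* count f
      many u y z≡ p≡ = ≤-complement ((y ℕ.* u ℕ.+ y) ℕ.* (p ℕ.* p ^ m) ℕ.+ z ℕ.* M)
          (trans (cong (λ v → v ℕ.* (p ℕ.* p ^ m) ℕ.+ ((y ℕ.* u ℕ.+ y) ℕ.* (p ℕ.* p ^ m) ℕ.+ z ℕ.* M)) c′≡)
            (trans (manyZeros z u y p (p ^ m)) (cong (ℕ._* M) p≡)))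
          (ℕ.≤-trans (sum-gap (sliceCount f) (p ^ suc (suc a₁)) M gap)
            (ℕ.+-monoʳ-≤ (p ^ suc (suc a₁) ℕ.* count f) (ℕ.m≤n+m (z ℕ.* M) _)))
        where
        M = p ℕ.* ((u ℕ.+ 2) ℕ.* p ^ m)
        regroup : ∀ c u y → suc (c ℕ.+ u ℕ.+ suc y) ≡ c ℕ.+ (u ℕ.+ y ℕ.+ 2)
        regroup = solve-∀
        c′≡ : c′ ≡ u ℕ.+ y ℕ.+ 2
        c′≡ = ℕ.+-cancelˡ-≡ c _ _ (trans c+c′ (trans (cong suc (trans (sym p≡) (cong (ℕ._+ suc y) z≡))) (regroup c u y)))
        p₁≡ : p₁ ≡ c ℕ.+ u ℕ.+ y
        p₁≡ = ℕ.suc-injective (trans (sym p≡) (trans (ℕ.+-suc z y) (cong (λ z → suc (z ℕ.+ y)) z≡)))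
        regroup₁ : ∀ A c u y → (c ℕ.+ u ℕ.+ y) ℕ.+ A ℕ.+ c ≡ (c ℕ.+ u) ℕ.+ (A ℕ.+ (c ℕ.+ y))
        regroup₁ = solve-∀
        regroup₂ : ∀ c u y → c ℕ.+ y ℕ.+ (u ℕ.+ 2) ≡ suc (suc (c ℕ.+ u ℕ.+ y))
        regroup₂ = solve-∀
        n∸z≤ : n ∸ z ℕ.≤ a₁ ℕ.* p₁ ℕ.+ (c ℕ.+ y)
        n∸z≤ = ℕ.m≤n+o⇒m∸n≤o n z (subst (n ℕ.≤_)
          (trans (cong (λ v → v ℕ.+ a₁ ℕ.* p₁ ℕ.+ c) p₁≡) (trans (regroup₁ (a₁ ℕ.* p₁) c u y)
            (cong (ℕ._+ (a₁ ℕ.* p₁ ℕ.+ (c ℕ.+ y))) (sym z≡)))) n≤)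
        gap : ∀ t → sliceCount f t ≢ 0 → M ℕ.≤ p ^ suc (suc a₁) ℕ.* sliceCount f t
        gap t ht = subst (M ℕ.≤_) (sym (ℕ.*-assoc p (p ^ suc a₁) _)) (ℕ.*-monoʳ-≤ p
          (minWeight m (slice-Deg d t) ht a₁ (c ℕ.+ y) (u ℕ.+ 2) n∸z≤
            (ℕ.≤-trans 1≤c (ℕ.m≤m+n c y)) (ℕ.≤-trans (s≤s z≤n) (ℕ.m≤n+m 2 u))
            (trans (regroup₂ c u y) (cong (λ v → suc (suc v)) (sym p₁≡)))))

  -- Linear algebra over K and automorphisms

  0v : ∀ {m} → V m
  0v = replicate _ zero

  infixr 7 _·_
  _·_ : ∀ {m} → K → V m → V m
  μ · x = Vec.map (μ ⊗_) x

  zero-· : ∀ {m} (x : V m) → zero · x ≡ 0v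
  zero-· [] = refl
  zero-· (t ∷ x) = cong₂ _∷_ (⊗-zeroˡ t) (zero-· x)

  ·-solve : ∀ {m μ} → μ ≢ zero → (z : V m) → ∃ λ x → μ · x ≡ z
  ·-solve μ≢0 [] = [] , refl
  ·-solve μ≢0 (t ∷ z) with ⊗-solve μ≢0 t | ·-solve μ≢0 z
  ... | s , es | x , ex = s ∷ x , cong₂ _∷_ es ex

  dot : ∀ {m} → V m → V m → K
  dot [] [] = zero
  dot (l ∷ λs) (t ∷ x) = l ⊗ t ⊕ dot λs x

  dot-0v : ∀ {m} (λs : V m) → dot λs 0v ≡ zero
  dot-0v [] = refl
  dot-0v (l ∷ λs) = trans (cong₂ _⊕_ (⊗-zeroʳ l) (dot-0v λs)) (⊕-identityˡ zero)

  0v-dot : ∀ {m} (x : V m) → dot 0v x ≡ zero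
  0v-dot [] = refl
  0v-dot (t ∷ x) = trans (cong₂ _⊕_ (⊗-zeroˡ t) (0v-dot x)) (⊕-identityˡ zero)

  dot-· : ∀ {m} (λs : V m) μ x → dot λs (μ · x) ≡ μ ⊗ dot λs x
  dot-· [] μ [] = sym (⊗-zeroʳ μ)
  dot-· (l ∷ λs) μ (t ∷ x) = trans (cong₂ _⊕_ swap⊗ (dot-· λs μ x)) (sym (⊗-distribˡ-⊕ μ _ _))
    where
    swap⊗ : l ⊗ (μ ⊗ t) ≡ μ ⊗ (l ⊗ t)
    swap⊗ = trans (sym (⊗-assoc l μ t)) (trans (cong (_⊗ t) (⊗-comm l μ)) (⊗-assoc μ l t))

  Affine-⊕ : ∀ {m} {u v : V m → K} → Affine (ι ∘ u) → Affine (ι ∘ v) → Affine (λ x → ι (u x ⊕ v x))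
  Affine-⊕ au av = add au av (λ x → ι-⊕ _ _)

  tail-affine : ∀ {m} → AffineMap {suc m} tail
  tail-affine i = Affine-resp (λ { (_ ∷ x) → refl }) (coordinate (suc i))

  dot-affine : ∀ {m} (λs : V m) → Affine (λ x → ι (dot λs x))
  dot-affine [] = const (ι zero) (λ { [] → refl })
  dot-affine (l ∷ λs) = Affine-resp (λ { (t ∷ x) → refl }) (Affine-⊕
    {u = λ x → l ⊗ lookup x zero} {v = λ x → dot λs (tail x)}
    (coord zero (ι l) (λ x → ι-⊗ l _)) (Affine-∘ {φ = tail} tail-affine (dot-affine λs)))

  -- A linear automorphism seen through its effects: `affine` preserves degrees, `scale` preserves
  -- homogeneity, and `measure` stands in for invertibility by preserving all sums.
  record Aut (m : ℕ) : Set where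
    field
      to      : V m → V m
      affine  : AffineMap to
      scale   : ∀ μ x → to (μ · x) ≡ μ · to x
      measure : ∀ w → S m (w ∘ to) ≡ S m w

    to-0v : to 0v ≡ 0v
    to-0v = trans (cong to (sym (zero-· 0v))) (trans (scale zero 0v) (zero-· (to 0v)))

  open Aut public

  idᵃ : ∀ {m} → Aut m
  idᵃ = record { to = id ; affine = coordinate ; scale = λ _ _ → refl ; measure = λ _ → refl }

  Deg-aut : ∀ {m n} {f : V m → Fin q} (φ : Aut m) → Deg n f → Deg n (f ∘ to φ)
  Deg-aut φ = Deg-∘ {φ = to φ} (affine φ)

  Deg-slice : ∀ {m n} {f : V (suc m) → Fin q} t → Deg n f → Deg n (λ x → f (t ∷ x))
  Deg-slice t = Deg-∘ {φ = t ∷_} (slice-affine t)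

  infixr 9 _∘ᵃ_
  _∘ᵃ_ : ∀ {m} → Aut m → Aut m → Aut m
  φ ∘ᵃ ψ = record
    { to = to φ ∘ to ψ
    ; affine = λ i → Affine-∘ (affine ψ) (affine φ i)
    ; scale = λ μ x → trans (cong (to φ) (scale ψ μ x)) (scale φ μ (to ψ x))
    ; measure = λ w → trans (measure ψ (w ∘ to φ)) (measure φ w) }

  liftᵃ : ∀ {m} → Aut m → Aut (suc m)
  liftᵃ {m} φ = record
    { to = λ { (t ∷ x) → t ∷ to φ x }
    ; affine = λ { zero → Affine-resp (λ { (_ ∷ _) → refl }) (coordinate zero)
                 ; (suc i) → Affine-resp (λ { (_ ∷ _) → refl }) (Affine-∘ {φ = tail} tail-affine (affine φ i)) }
    ; scale = λ { μ (t ∷ x) → cong (μ ⊗ t ∷_) (scale φ μ x) }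
    ; measure = λ w → sum-cong (λ t → measure φ (λ x → w (t ∷ x))) }

  swapᵃ : ∀ {m} → Aut (suc (suc m))
  swapᵃ {m} = record
    { to = λ { (s ∷ t ∷ x) → t ∷ s ∷ x }
    ; affine = λ { zero → Affine-resp (λ { (_ ∷ _ ∷ _) → refl }) (coordinate (suc zero))
                 ; (suc zero) → Affine-resp (λ { (_ ∷ _ ∷ _) → refl }) (coordinate zero)
                 ; (suc (suc i)) → Affine-resp (λ { (_ ∷ _ ∷ _) → refl }) (coordinate (suc (suc i))) }
    ; scale = λ { μ (s ∷ t ∷ x) → refl }
    ; measure = λ w → sum-comm (λ s t → S m (λ x → w (t ∷ s ∷ x))) }

  -- Carries the hyperplane `t = 0` to the graph of `dot λs`, so that a chosen hyperplane can be
  -- made a slice.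
  shearᵃ : ∀ {m} → V m → Aut (suc m)
  shearᵃ {m} λs = record
    { to = λ { (t ∷ x) → dot λs x ⊕ t ∷ x }
    ; affine = λ { zero → Affine-resp (λ { (_ ∷ _) → refl })
                     (Affine-⊕ {u = λ x → dot λs (tail x)} {v = λ x → lookup x zero}
                       (Affine-∘ {φ = tail} tail-affine (dot-affine λs)) (coordinate zero))
                 ; (suc i) → Affine-resp (λ { (_ ∷ _) → refl }) (coordinate (suc i)) }
    ; scale = λ { μ (t ∷ x) → cong (_∷ μ · x) (trans (cong (_⊕ μ ⊗ t) (dot-· λs μ x)) (sym (⊗-distribˡ-⊕ μ _ _))) }
    -- For fixed `x` the shear only translates `t`, so the sum over `t` is taken first.
    ; measure = λ w → begin
        sum (λ t → S m (λ x → w (dot λs x ⊕ t ∷ x))) ≡⟨ sym (S-sum m (λ t x → w (dot λs x ⊕ t ∷ x))) ⟩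
        S m (λ x → sum (λ t → w (dot λs x ⊕ t ∷ x))) ≡⟨ S-cong m (λ x → sum-injective (⊕-injective (dot λs x)) (λ t → w (t ∷ x))) ⟩
        S m (λ x → sum (λ t → w (t ∷ x))) ≡⟨ S-sum m (λ t x → w (t ∷ x)) ⟩
        sum (λ t → S m (λ x → w (t ∷ x))) ∎ }
    where
    open ≡-Reasoning

  -- Counting away from the origin

  nonzero : ∀ {m} → V m → Bool
  nonzero [] = false
  nonzero (zero ∷ x) = nonzero x
  nonzero (suc _ ∷ x) = true

  nonzero-false : ∀ {m} (x : V m) → nonzero x ≡ false → x ≡ 0v
  nonzero-false [] _ = refl
  nonzero-false (zero ∷ x) e = cong (zero ∷_) (nonzero-false x e)

  nonzero-∷ : ∀ {m} t (x : V m) → nonzero x ≡ true → nonzero (t ∷ x) ≡ true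
  nonzero-∷ zero x e = e
  nonzero-∷ (suc t) x e = refl

  punctured : ∀ {m} → (V m → ℕ) → V m → ℕ
  punctured w x = if nonzero x then w x else 0

  S-punctured : ∀ m (w : V m → ℕ) → S m w ≡ w 0v ℕ.+ S m (punctured w)
  S-punctured zero w = sym (ℕ.+-identityʳ _)
  S-punctured (suc m) w = begin
    sum (λ t → S m (λ x → w (t ∷ x))) ≡⟨ sum-suc _ ⟩
    S m (λ x → w (zero ∷ x)) ℕ.+ rest ≡⟨ cong (ℕ._+ rest) (S-punctured m (λ x → w (zero ∷ x))) ⟩
    w 0v ℕ.+ S m (λ x → punctured w (zero ∷ x)) ℕ.+ rest ≡⟨ ℕ.+-assoc (w 0v) _ _ ⟩
    w 0v ℕ.+ (S m (λ x → punctured w (zero ∷ x)) ℕ.+ rest) ≡⟨ cong (w 0v ℕ.+_) (sym (sum-suc _)) ⟩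
    w 0v ℕ.+ sum (λ t → S m (λ x → punctured w (t ∷ x))) ∎
    where
    open ≡-Reasoning
    rest = sum (λ t → S m (λ x → w (suc t ∷ x)))

  -- The size of the support without the origin; for a codeword this is `q - 1` times the weight.
  N : ∀ {m} → (V m → Fin q) → ℕ
  N {m} f = S m (punctured (λ x → supp (f x)))

  count-N : ∀ {m} (f : V m → Fin q) → count f ≡ supp (f 0v) ℕ.+ N f
  count-N {m} f = S-punctured m (λ x → supp (f x))

  N-suc : ∀ {m} (f : V (suc m) → Fin q) → N f ≡ N (λ x → f (zero ∷ x)) ℕ.+ sum (λ t → sliceCount f (suc t))
  N-suc f = sum-suc _

  count-aut : ∀ {m} (φ : Aut m) f → count (f ∘ to φ) ≡ count f
  count-aut φ f = measure φ (λ x → supp (f x))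

  -- The full count is preserved and the origin is fixed, so the contribution of the origin cancels.
  N-aut : ∀ {m} (φ : Aut m) f → N (f ∘ to φ) ≡ N f
  N-aut φ f = ℕ.+-cancelˡ-≡ (supp (f 0v)) _ _ (begin
    supp (f 0v) ℕ.+ N (f ∘ to φ) ≡⟨ cong (λ y → supp (f y) ℕ.+ N (f ∘ to φ)) (sym (to-0v φ)) ⟩
    supp (f (to φ 0v)) ℕ.+ N (f ∘ to φ) ≡⟨ sym (count-N (f ∘ to φ)) ⟩
    count (f ∘ to φ) ≡⟨ count-aut φ f ⟩
    count f ≡⟨ count-N f ⟩
    supp (f 0v) ℕ.+ N f ∎)
    where open ≡-Reasoning

  -- Homogeneous functions and averaging over hyperplanes

  Homogeneous : ∀ {m} → (V m → Fin q) → Set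
  Homogeneous f = ∀ μ → μ ≢ zero → ∀ x → f (μ · x) ≡ f x

  Homogeneous-∘ : ∀ {m} {f : V m → Fin q} (φ : Aut m) → Homogeneous f → Homogeneous (f ∘ to φ)
  Homogeneous-∘ {f = f} φ h μ μ≢0 x = trans (cong f (scale φ μ x)) (h μ μ≢0 (to φ x))

  S-swap : ∀ m k (w : V m → V k → ℕ) → S m (λ x → S k (w x)) ≡ S k (λ y → S m (λ x → w x y))
  S-swap zero k w = refl
  S-swap (suc m) k w = trans (sum-cong (λ t → S-swap m k (λ x → w (t ∷ x))))
    (sym (S-sum k (λ t y → S m (λ x → w (t ∷ x) y))))

  S-≤⇒∃ : ∀ m (w : V m → ℕ) B → S m w ℕ.≤ p ^ m ℕ.* B → ∃ λ x → w x ℕ.≤ B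
  S-≤⇒∃ zero w B h = [] , subst (w [] ℕ.≤_) (ℕ.*-identityˡ B) h
  S-≤⇒∃ (suc m) w B h with sum-≤⇒∃ (λ t → S m (λ x → w (t ∷ x))) (p ^ m ℕ.* B)
                               (subst (S (suc m) w ℕ.≤_) (ℕ.*-assoc p (p ^ m) B) h)
  ... | t , ht with S-≤⇒∃ m (λ x → w (t ∷ x)) B ht
  ...   | x , hx = t ∷ x , hx

  -- If the tail of `x` is nonzero, induct on it: the first product only translates the values.
  -- Otherwise the value is `l ⊗ t` with `t ≠ 0`, and multiplication by `t` permutes K. The factor
  -- `p` clears the denominator of `p ^ (m - 1)`.
  dot-equidistributed : ∀ m (x : V m) → nonzero x ≡ true → (φ : K → ℕ) →
    p ℕ.* S m (λ λs → φ (dot λs x)) ≡ p ^ m ℕ.* sum φ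
  dot-equidistributed (suc m) (t ∷ x) nz φ with nonzero x in eq
  ... | true = begin
      p ℕ.* sum (λ l → S m (λ λs → φ (l ⊗ t ⊕ dot λs x))) ≡⟨ sym (sum-*ˡ p (λ l → S m (λ λs → φ (l ⊗ t ⊕ dot λs x)))) ⟩
      sum (λ l → p ℕ.* S m (λ λs → φ (l ⊗ t ⊕ dot λs x))) ≡⟨ sum-cong (λ l → trans
        (dot-equidistributed m x eq (λ k → φ (l ⊗ t ⊕ k)))
        (cong (p ^ m ℕ.*_) (sum-injective (⊕-injective (l ⊗ t)) φ))) ⟩
      sum (λ l → p ^ m ℕ.* sum φ) ≡⟨ sum-const p _ ⟩
      p ℕ.* (p ^ m ℕ.* sum φ) ≡⟨ sym (ℕ.*-assoc p (p ^ m) (sum φ)) ⟩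
      p ^ suc m ℕ.* sum φ ∎
    where open ≡-Reasoning
  dot-equidistributed (suc m) (zero ∷ x) nz φ | false = case trans (sym nz) eq of λ ()
  dot-equidistributed (suc m) (suc t ∷ x) nz φ | false with nonzero-false x eq
  ... | refl = begin
      p ℕ.* sum (λ l → S m (λ λs → φ (l ⊗ suc t ⊕ dot λs 0v))) ≡⟨ cong (p ℕ.*_) (sum-cong (λ l → trans
        (S-cong m (λ λs → cong φ (trans (cong (l ⊗ suc t ⊕_) (dot-0v λs))
          (trans (⊕-identityʳ _) (⊗-comm l (suc t)))))) (S-const m _))) ⟩
      p ℕ.* sum (λ l → p ^ m ℕ.* φ (suc t ⊗ l)) ≡⟨ cong (p ℕ.*_) (sum-*ˡ (p ^ m) (λ l → φ (suc t ⊗ l))) ⟩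
      p ℕ.* (p ^ m ℕ.* sum (λ l → φ (suc t ⊗ l))) ≡⟨ cong (λ y → p ℕ.* (p ^ m ℕ.* y))
        (sum-injective (⊗-injective {suc t} (λ ())) φ) ⟩
      p ℕ.* (p ^ m ℕ.* sum φ) ≡⟨ sym (ℕ.*-assoc p (p ^ m) (sum φ)) ⟩
      p ^ suc m ℕ.* sum φ ∎
    where open ≡-Reasoning

  -- Parametrizes the hyperplanes that do not contain the first coordinate axis.
  graph : ∀ {m} → V m → V m → V (suc m)
  graph λs x = dot λs x ∷ x

  graph-affine : ∀ {m} (λs : V m) → AffineMap (graph λs)
  graph-affine λs zero = dot-affine λs
  graph-affine λs (suc i) = coordinate i

  graph-0v : ∀ {m} (λs : V m) → graph λs 0v ≡ 0v
  graph-0v λs = cong (_∷ 0v) (dot-0v λs)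

  Homogeneous-graph : ∀ {m} {f : V (suc m) → Fin q} (λs : V m) → Homogeneous f → Homogeneous (f ∘ graph λs)
  Homogeneous-graph {f = f} λs h μ μ≢0 x =
    trans (cong (λ t → f (t ∷ μ · x)) (dot-· λs μ x)) (h μ μ≢0 (graph λs x))

  -- Average over all `p ^ m` graphs: a vector with nonzero tail lies on `p ^ (m - 1)` of them, and
  -- a vector `(t, 0)` with `t ≠ 0` on none.
  light-hyperplane : ∀ m (f : V (suc m) → Fin q) → ∃ λ λs → p ℕ.* N (f ∘ graph λs) ℕ.≤ N f
  light-hyperplane m f = S-≤⇒∃ m (λ λs → p ℕ.* N (f ∘ graph λs)) (N f) (begin
    S m (λ λs → p ℕ.* N (f ∘ graph λs)) ≡⟨ S-*ˡ m p (λ λs → N (f ∘ graph λs)) ⟩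
    p ℕ.* S m (λ λs → N (f ∘ graph λs)) ≡⟨ cong (p ℕ.*_) (S-swap m m _) ⟩
    p ℕ.* S m (λ x → S m (λ λs → punctured (λ y → supp (f (graph λs y))) x)) ≡⟨ sym (S-*ˡ m p (λ x → S m (λ λs → punctured (λ y → supp (f (graph λs y))) x))) ⟩
    S m (λ x → p ℕ.* S m (λ λs → punctured (λ y → supp (f (graph λs y))) x)) ≤⟨ S-mono m pointwise ⟩
    S m (λ x → p ^ m ℕ.* sum (λ t → w (t ∷ x))) ≡⟨ S-*ˡ m (p ^ m) (λ x → sum (λ t → w (t ∷ x))) ⟩
    p ^ m ℕ.* S m (λ x → sum (λ t → w (t ∷ x))) ≡⟨ cong (p ^ m ℕ.*_) (S-sum m (λ t x → w (t ∷ x))) ⟩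
    p ^ m ℕ.* N f ∎)
    where
    open ℕ.≤-Reasoning
    w : V (suc m) → ℕ
    w = punctured (λ x → supp (f x))
    pointwise : ∀ x → p ℕ.* S m (λ λs → punctured (λ y → supp (f (graph λs y))) x) ℕ.≤ p ^ m ℕ.* sum (λ t → w (t ∷ x))
    pointwise x with nonzero x in eq
    ... | false = ℕ.≤-trans (ℕ.≤-reflexive (trans (cong (p ℕ.*_) (trans (S-const m 0) (ℕ.*-zeroʳ (p ^ m)))) (ℕ.*-zeroʳ p))) z≤n
    ... | true = ℕ.≤-reflexive (trans (dot-equidistributed m x eq (λ t → supp (f (t ∷ x))))
      (cong (p ^ m ℕ.*_) (sum-cong (λ t → cong (if_then supp (f (t ∷ x)) else 0) (sym (nonzero-∷ t x eq))))))

-- Numerical inequalities for `p` at least 12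

private
  from-11 : (Q : ℕ → Set) → (∀ k → Q (11 ℕ.+ k)) → ∀ {a} → 11 ℕ.≤ a → Q a
  from-11 Q h {a} le = subst Q (ℕ.m+[n∸m]≡n le) (h (a ∸ 11))

  -- With `a = p - 1` this is `7 p ≤ 8 (p - 1)`; at `p = 12 + k` the slack is `4 + k`.
  parallel-arith : ∀ {a} P → 11 ℕ.≤ a → 7 ℕ.* (suc a ℕ.* P) ℕ.≤ 4 ℕ.* (a ℕ.* (2 ℕ.* P))
  parallel-arith P = from-11 (λ a → 7 ℕ.* (suc a ℕ.* P) ℕ.≤ 4 ℕ.* (a ℕ.* (2 ℕ.* P)))
    (λ k → ℕ.m+n≤o⇒m≤o _ (ℕ.≤-reflexive (identity k P)))
    where
    identity : ∀ k P → 7 ℕ.* ((12 ℕ.+ k) ℕ.* P) ℕ.+ (4 ℕ.+ k) ℕ.* P ≡ 4 ℕ.* ((11 ℕ.+ k) ℕ.* (2 ℕ.* P))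
    identity = solve-∀

  -- With `a = p - 1` this is `p² - 12 p + 4 ≥ 0`, which holds from `p = 12` on and fails at
  -- `p = 11`. The slack at `p = 12 + k` is `k² + 12 k + 4`.
  crossing-arith : ∀ {a} P → 11 ℕ.≤ a →
    7 ℕ.* (suc a ℕ.* (suc a ℕ.* P)) ℕ.+ 4 ℕ.* P ℕ.≤ 4 ℕ.* (suc a ℕ.* P ℕ.+ a ℕ.* (2 ℕ.* (a ℕ.* P)))
  crossing-arith P = from-11 (λ a → 7 ℕ.* (suc a ℕ.* (suc a ℕ.* P)) ℕ.+ 4 ℕ.* P ℕ.≤
      4 ℕ.* (suc a ℕ.* P ℕ.+ a ℕ.* (2 ℕ.* (a ℕ.* P))))
    (λ k → ℕ.m+n≤o⇒m≤o _ (ℕ.≤-reflexive (identity k P)))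
    where
    identity : ∀ k P → 7 ℕ.* ((12 ℕ.+ k) ℕ.* ((12 ℕ.+ k) ℕ.* P)) ℕ.+ 4 ℕ.* P ℕ.+ (4 ℕ.+ 12 ℕ.* k ℕ.+ k ℕ.* k) ℕ.* P ≡
      4 ℕ.* ((12 ℕ.+ k) ℕ.* P ℕ.+ (11 ℕ.+ k) ℕ.* (2 ℕ.* ((11 ℕ.+ k) ℕ.* P)))
    identity = solve-∀

  -- With `p = a + b + 3` and `z = a + 1` empty subslices, this is
  -- `(p - z)(z + 1) = 2 (p - 1) + a b`, scaled.
  slices-arith : ∀ a b P → 2 ℕ.* ((a ℕ.+ 2 ℕ.+ b) ℕ.* P) ℕ.+ (a ℕ.* b ℕ.* P ℕ.+ suc a ℕ.* ((suc a ℕ.+ 1) ℕ.* P)) ≡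
    suc (a ℕ.+ 2 ℕ.+ b) ℕ.* ((suc a ℕ.+ 1) ℕ.* P)
  slices-arith = solve-∀

-- The gap for homogeneous polynomials

module Gap (p₁ : ℕ) (p-prime : Prime (suc p₁)) (11≤p₁ : 11 ℕ.≤ p₁) {q : ℕ} (q≡pp : q ≡ suc p₁ ℕ.* suc p₁)
           (𝔽 : FieldOn q) where
  open PrimeSubfield p₁ p-prime q≡pp 𝔽 public

  private
    1≤p₁ : 1 ℕ.≤ p₁
    1≤p₁ = ℕ.≤-trans (s≤s z≤n) 11≤p₁

    -- Passes the smallness hypothesis to a hyperplane that holds at most `N / p` of the points.
    restrict-bound : ∀ A P {M N} → p ℕ.* M ℕ.≤ N → 4 ℕ.* (A ℕ.* N) ℕ.< 7 ℕ.* (p ℕ.* P) → 4 ℕ.* (A ℕ.* M) ℕ.< 7 ℕ.* P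
    restrict-bound A P {M} {N} pM≤N lt = ℕ.*-cancelˡ-< p _ _ (begin-strict
      p ℕ.* (4 ℕ.* (A ℕ.* M)) ≡⟨ shuffle p A M ⟩
      4 ℕ.* (A ℕ.* (p ℕ.* M)) ≤⟨ ℕ.*-monoʳ-≤ 4 (ℕ.*-monoʳ-≤ A pM≤N) ⟩
      4 ℕ.* (A ℕ.* N) <⟨ lt ⟩
      7 ℕ.* (p ℕ.* P) ≡⟨ shuffle′ p P ⟩
      p ℕ.* (7 ℕ.* P) ∎)
      where
      open ℕ.≤-Reasoning
      shuffle : ∀ p A M → p ℕ.* (4 ℕ.* (A ℕ.* M)) ≡ 4 ℕ.* (A ℕ.* (p ℕ.* M))
      shuffle = solve-∀
      shuffle′ : ∀ p P → 7 ℕ.* (p ℕ.* P) ≡ p ℕ.* (7 ℕ.* P)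
      shuffle′ = solve-∀

  -- Scaling by `t / s` carries the slice at `s` to the slice at `t`.
  slice-homogeneous : ∀ {m} {f : V (suc m) → Fin q} → Homogeneous f → ∀ {s t} → s ≢ zero → t ≢ zero →
    sliceCount f s ≢ 0 → sliceCount f t ≢ 0
  slice-homogeneous {m} {f} hom {s} {t} s≢0 t≢0 h with S≢0 m (λ x → supp (f (s ∷ x))) h | ⊗-solve s≢0 t
  ... | x , hx | μ , sμ≡t = count≢0 (λ x → f (t ∷ x)) (μ · x) λ e → hx (supp-0 (trans (sym (hom μ μ≢0 (s ∷ x)))
      (trans (cong (λ k → f (k ∷ μ · x)) (trans (⊗-comm μ s) sμ≡t)) e)))
    where
    μ≢0 : μ ≢ zero
    μ≢0 refl = t≢0 (trans (sym sμ≡t) (⊗-zeroʳ s))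

  N-≥ : ∀ {m} (f : V (suc m) → Fin q) A M → (∀ t → M ℕ.≤ A ℕ.* sliceCount f (suc t)) → p₁ ℕ.* M ℕ.≤ A ℕ.* N f
  N-≥ f A M h = begin
    p₁ ℕ.* M ≤⟨ sum-≥ M h ⟩
    sum (λ t → A ℕ.* sliceCount f (suc t)) ≡⟨ sum-*ˡ A (λ t → sliceCount f (suc t)) ⟩
    A ℕ.* sum (λ t → sliceCount f (suc t)) ≤⟨ ℕ.*-monoʳ-≤ A (ℕ.≤-trans (ℕ.m≤n+m _ _) (ℕ.≤-reflexive (sym (N-suc f)))) ⟩
    A ℕ.* N f ∎
    where open ℕ.≤-Reasoning

  -- By induction `f` is zero on a light hyperplane. Dividing by its equation leaves degree below
  -- `r (p - 1)`, so if `f` is nonzero each of the `p - 1` parallel slices, of dimension `d` say,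
  -- carries at least `2 p ^ (d - r)` points; as `8 (p - 1) ≥ 7 p`, this is too many.
  vanishes : ∀ m r {f : V m → Fin q} → Deg (suc (r ℕ.* p₁)) f → Homogeneous f → f 0v ≡ 0# →
    4 ℕ.* (p ^ r ℕ.* N f) ℕ.< 7 ℕ.* p ^ m → ∀ x → f x ≡ 0#
  vanishes zero r d hom f0≡0 bound [] = f0≡0
  vanishes (suc m) r {f} d hom f0≡0 bound with light-hyperplane m f
  ... | λs , light = result
    where
    φ = shearᵃ λs
    h = f ∘ to φ
    g≡0 : ∀ x → f (graph λs x) ≡ 0#
    g≡0 = vanishes m r (Deg-∘ (graph-affine λs) d) (Homogeneous-graph λs hom)
      (trans (cong f (graph-0v λs)) f0≡0) (restrict-bound (p ^ r) (p ^ m) light bound)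
    h0≡0 : ∀ x → h (zero ∷ x) ≡ 0#
    h0≡0 x = trans (cong (λ t → f (t ∷ x)) (⊕-identityʳ _)) (g≡0 x)
    slice≢0 : count h ≢ 0 → ∀ t → sliceCount h (suc t) ≢ 0
    slice≢0 h≢0 t with nonzero-slice h h≢0
    ... | s , hs = slice-homogeneous (Homogeneous-∘ φ hom)
      (λ { refl → hs (trans (S-cong m (λ x → supp-0 (h0≡0 x))) (trans (S-const m 0) (ℕ.*-zeroʳ (p ^ m)))) }) (λ ()) hs
    degree : ∀ t → Deg (r ℕ.* p₁) (λ x → h (t ∷ x))
    degree = slice-Deg-vanishing (zero ∷ []) ([] ∷ []) (Deg-aut φ d) (λ { (here refl) → h0≡0 })
    slice-≥ : count h ≢ 0 → ∀ t → 2 ℕ.* p ^ m ℕ.≤ p ^ r ℕ.* sliceCount h (suc t)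
    slice-≥ h≢0 t = go r (degree (suc t)) (slice≢0 h≢0 t)
      where
      go : ∀ r → Deg (r ℕ.* p₁) (λ x → h (suc t ∷ x)) → sliceCount h (suc t) ≢ 0 →
        2 ℕ.* p ^ m ℕ.≤ p ^ r ℕ.* sliceCount h (suc t)
      -- For `r = 0` the slice has degree below 0, so it is zero.
      go zero d₀ h≢0 = ⊥-elim (h≢0 (trans (S-cong m (λ x → supp-0 (Deg-0 d₀ x))) (trans (S-const m 0) (ℕ.*-zeroʳ (p ^ m)))))
      -- Degree below `(r + 1)(p - 1)` is the case `c = p - 1`, `c′ = 2` of the Reed-Muller bound.
      go (suc r) d₀ h≢0 = minWeight m d₀ h≢0 r p₁ 2 (ℕ.≤-reflexive (ℕ.+-comm p₁ _)) 1≤p₁ (s≤s z≤n) (ℕ.+-comm p₁ 2)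
    result : ∀ x → f x ≡ 0#
    result with count h ℕ.≟ 0
    ... | yes e = count≡0 f (trans (sym (count-aut φ f)) e)
    ... | no h≢0 = ⊥-elim (ℕ.<⇒≱ bound (begin
        7 ℕ.* (p ℕ.* p ^ m) ≤⟨ parallel-arith (p ^ m) 11≤p₁ ⟩
        4 ℕ.* (p₁ ℕ.* (2 ℕ.* p ^ m)) ≤⟨ ℕ.*-monoʳ-≤ 4 (N-≥ h (p ^ r) (2 ℕ.* p ^ m) (slice-≥ h≢0)) ⟩
        4 ℕ.* (p ^ r ℕ.* N h) ≡⟨ cong (λ y → 4 ℕ.* (p ^ r ℕ.* y)) (N-aut φ f) ⟩
        4 ℕ.* (p ^ r ℕ.* N f) ∎))
      where open ℕ.≤-Reasoning

  -- The hyperplanes through the subspace `x₀ = x₁ = 0` are `x₀ = 0` and `x₁ = c x₀`. For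
  -- homogeneous `h`, points with `x₀ = 1` represent the latter off that subspace.
  direction : ∀ {m} → (V (suc (suc m)) → Fin q) → K → ℕ
  direction h c = count (λ z → h (one ∷ c ∷ z))

  module _ {m : ℕ} {h : V (suc (suc m)) → Fin q} (hom : Homogeneous h)
           (h-axis : ∀ y z → y ≢ zero → h (zero ∷ y ∷ z) ≡ 0#) where

    line : ∀ b → b ≢ zero → ∀ c z → h (b ∷ b ⊗ c ∷ b · z) ≡ h (one ∷ c ∷ z)
    line b b≢0 c z = trans (cong (λ k → h (k ∷ b ⊗ c ∷ b · z)) (sym (⊗-identityʳ b))) (hom b b≢0 (one ∷ c ∷ z))

    module _ (c₀ : K) where

      -- Introduces the coordinates `a = x₁ - c₀ x₀` and `b = x₀`, so that the hyperplane of
      -- direction `c₀` becomes the slice `a = 0`.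
      tilt : Aut (suc (suc m))
      tilt = swapᵃ ∘ᵃ shearᵃ (c₀ ∷ 0v)

      tilt-≡ : ∀ a b z → to tilt (a ∷ b ∷ z) ≡ b ∷ c₀ ⊗ b ⊕ a ∷ z
      tilt-≡ a b z = cong (λ k → b ∷ k ⊕ a ∷ z) (trans (cong (c₀ ⊗ b ⊕_) (0v-dot z)) (⊕-identityʳ _))

      tilt-zero : ∀ {a} → a ≢ zero → ∀ z → h (to tilt (a ∷ zero ∷ z)) ≡ 0#
      tilt-zero {a} a≢0 z = trans (cong h (tilt-≡ a zero z)) (h-axis _ z
        (λ e → a≢0 (trans (sym (⊕-identityˡ a)) (trans (cong (_⊕ a) (sym (⊗-zeroʳ c₀))) e))))

      -- Points with `b = 0` are covered by `h-axis`. Any other point scales to `x₀ = 1`, and there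
      -- its direction differs from `c₀` because `a ≠ 0`.
      one-direction : (∀ c → c ≢ c₀ → direction h c ≡ 0) → ∀ a x → a ≢ zero → h (to tilt (a ∷ x)) ≡ 0#
      one-direction other a (b ∷ z) a≢0 with b Fin.≟ zero
      ... | yes refl = tilt-zero a≢0 z
      ... | no b≢0 with ⊗-solve b≢0 (c₀ ⊗ b ⊕ a) | ·-solve b≢0 z
      ...   | c , ec | z′ , refl = begin
          h (to tilt (a ∷ b ∷ b · z′)) ≡⟨ cong h (tilt-≡ a b _) ⟩
          h (b ∷ c₀ ⊗ b ⊕ a ∷ b · z′) ≡⟨ cong (λ k → h (b ∷ k ∷ b · z′)) (sym ec) ⟩
          h (b ∷ b ⊗ c ∷ b · z′) ≡⟨ line b b≢0 c z′ ⟩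
          h (one ∷ c ∷ z′) ≡⟨ count≡0 (λ z → h (one ∷ c ∷ z)) (other c c≢c₀) z′ ⟩
          0# ∎
        where
        open ≡-Reasoning
        c≢c₀ : c ≢ c₀
        c≢c₀ refl = a≢0 (⊕-injective (c ⊗ b) (trans (sym ec) (trans (⊗-comm b c) (sym (⊕-identityʳ _)))))

      module _ {t : K} (t≢0 : t ≢ zero) where

        -- The hyperplane of direction `c` meets the slice `a = t` where `b (c - c₀) = t`, so
        -- different directions occupy different subslices.
        hit : ∀ {c} → c ≢ c₀ → direction h c ≢ 0 → ∃ λ b → b ⊗ c ≡ c₀ ⊗ b ⊕ t × count (λ z → h (to tilt (t ∷ b ∷ z))) ≢ 0
        hit {c} c≢c₀ hc with ⊕-solve c₀ c
        ... | d , refl with ⊗-solve (λ { refl → c≢c₀ (⊕-identityʳ c₀) }) t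
        ...   | b , db≡t with S≢0 m (λ z → supp (h (one ∷ c ∷ z))) hc
        ...     | z , hz = b , bc≡ , count≢0 (λ z → h (to tilt (t ∷ b ∷ z))) (b · z) (λ e → hz (supp-0 (begin
            h (one ∷ c ∷ z) ≡⟨ sym (line b b≢0 c z) ⟩
            h (b ∷ b ⊗ c ∷ b · z) ≡⟨ cong (λ k → h (b ∷ k ∷ b · z)) bc≡ ⟩
            h (b ∷ c₀ ⊗ b ⊕ t ∷ b · z) ≡⟨ cong h (sym (tilt-≡ t b (b · z))) ⟩
            h (to tilt (t ∷ b ∷ b · z)) ≡⟨ e ⟩
            0# ∎)))
          where
          open ≡-Reasoning
          bc≡ : b ⊗ (c₀ ⊕ d) ≡ c₀ ⊗ b ⊕ t
          bc≡ = trans (⊗-distribˡ-⊕ b c₀ d) (cong₂ _⊕_ (⊗-comm b c₀) (trans (⊗-comm b d) db≡t))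
          b≢0 : b ≢ zero
          b≢0 refl = t≢0 (trans (sym db≡t) (⊗-zeroʳ d))

        module _ {c₁ c₂ : K} (c₁≢c₂ : c₁ ≢ c₂) (c₁≢c₀ : c₁ ≢ c₀) (c₂≢c₀ : c₂ ≢ c₀)
                 (h₁ : direction h c₁ ≢ 0) (h₂ : direction h c₂ ≢ 0) where

          private
            G : V (suc m) → Fin q
            G x = h (to tilt (t ∷ x))
            b₁ = proj₁ (hit c₁≢c₀ h₁)
            b₂ = proj₁ (hit c₂≢c₀ h₂)
            G₁ = proj₂ (proj₂ (hit c₁≢c₀ h₁))
            G₂ = proj₂ (proj₂ (hit c₂≢c₀ h₂))
            G0≡0 : sliceCount G zero ≡ 0
            G0≡0 = trans (S-cong m (λ z → supp-0 (tilt-zero t≢0 z))) (trans (S-const m 0) (ℕ.*-zeroʳ (p ^ m)))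
            b₁≢b₂ : b₁ ≢ b₂
            b₁≢b₂ e = c₁≢c₂ (⊗-injective b₁≢0 (trans (proj₁ (proj₂ (hit c₁≢c₀ h₁)))
              (trans (cong (λ b → c₀ ⊗ b ⊕ t) e) (trans (sym (proj₁ (proj₂ (hit c₂≢c₀ h₂)))) (cong (_⊗ c₂) (sym e))))))
              where
              b₁≢0 : b₁ ≢ zero
              b₁≢0 e = G₁ (subst (λ b → sliceCount G b ≡ 0) (sym e) G0≡0)

          two-points : 2 ℕ.≤ count G
          two-points = ℕ.≤-trans (ℕ.+-mono-≤ (ℕ.n≢0⇒n>0 G₁) (ℕ.n≢0⇒n>0 G₂)) (sum-two (sliceCount G) b₁ b₂ b₁≢b₂)

          -- With `z` empty subslices, every other one has at least `(z + 1) p ^ m / p ^ (r + 1)`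
          -- points. The subslice `b = 0` is empty and two are not, so `1 ≤ z ≤ p - 2`; on this
          -- range `(p - z)(z + 1)` is smallest at the ends, where it equals `2 (p - 1)`.
          two-flats : ∀ {r} → Deg (suc (suc r ℕ.* p₁)) h → 2 ℕ.* (p₁ ℕ.* p ^ m) ℕ.≤ p ^ suc r ℕ.* count G
          two-flats {r} d = go (length Z) refl (∈-length (zeros-∈ (sliceCount G) G0≡0)) (length-zeros-two (sliceCount G) b₁≢b₂ G₁ G₂)
            where
            Z = zeros (sliceCount G)
            go : ∀ z → z ≡ length Z → 1 ℕ.≤ z → 2 ℕ.+ z ℕ.≤ p → 2 ℕ.* (p₁ ℕ.* p ^ m) ℕ.≤ p ^ suc r ℕ.* count G
            go (suc a) e _ le = split (p₁ ∸ (a ℕ.+ 2)) (sym (ℕ.m+[n∸m]≡n (subst (ℕ._≤ p₁) (ℕ.+-comm 2 a) (ℕ.s≤s⁻¹ le))))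
              where
              split : ∀ b → p₁ ≡ a ℕ.+ 2 ℕ.+ b → 2 ℕ.* (p₁ ℕ.* p ^ m) ℕ.≤ p ^ suc r ℕ.* count G
              split b p₁≡ = ≤-complement (a ℕ.* b ℕ.* p ^ m ℕ.+ length Z ℕ.* M)
                (subst₂ (λ P z → 2 ℕ.* (P ℕ.* p ^ m) ℕ.+ (a ℕ.* b ℕ.* p ^ m ℕ.+ z ℕ.* M) ≡ suc P ℕ.* M)
                  (sym p₁≡) e (slices-arith a b (p ^ m)))
                (ℕ.≤-trans (sum-gap (sliceCount G) (p ^ suc r) M gap) (ℕ.+-monoʳ-≤ (p ^ suc r ℕ.* count G) (ℕ.m≤n+m (length Z ℕ.* M) _)))
                where
                M = (suc a ℕ.+ 1) ℕ.* p ^ m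
                regroup : ∀ A a b → suc ((a ℕ.+ 2 ℕ.+ b) ℕ.+ A) ≡ suc a ℕ.+ (A ℕ.+ (2 ℕ.+ b))
                regroup = solve-∀
                regroup′ : ∀ a b → 2 ℕ.+ b ℕ.+ (suc a ℕ.+ 1) ≡ suc (suc (a ℕ.+ 2 ℕ.+ b))
                regroup′ = solve-∀
                gap : ∀ b → sliceCount G b ≢ 0 → M ℕ.≤ p ^ suc r ℕ.* sliceCount G b
                gap s hs = minWeight m (slice-Deg (Deg-slice t (Deg-aut tilt d)) s) hs r (2 ℕ.+ b) (suc a ℕ.+ 1)
                  (ℕ.m≤n+o⇒m∸n≤o _ (length Z) (ℕ.≤-reflexive (trans
                    (cong (λ P → suc (P ℕ.+ r ℕ.* p₁)) p₁≡) (trans (regroup (r ℕ.* p₁) a b) (cong (ℕ._+ _) e)))))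
                  (s≤s z≤n) (s≤s z≤n) (trans (regroup′ a b) (cong (λ P → suc (suc P)) (sym p₁≡)))

    -- Tilt along a third direction `c₀`. Every slice `a = t` with `t ≠ 0` then meets both given
    -- directions, and in the main case `two-flats` makes it heavy; the slice `a = 0` contains the
    -- origin, where `h` is nonzero, so Reed-Muller applies to it.
    two-directions : ∀ {r} → Deg (suc (suc r ℕ.* p₁)) h → h 0v ≢ 0# →
      ∀ {c₁ c₂} → c₁ ≢ c₂ → direction h c₁ ≢ 0 → direction h c₂ ≢ 0 →
      7 ℕ.* p ^ suc (suc m) ℕ.≤ 4 ℕ.* (p ^ suc r ℕ.* N h)
    two-directions {r} d h0≢0 {c₁} {c₂} c₁≢c₂ h₁ h₂
      with avoid-two (s≤s (ℕ.≤-trans (s≤s (s≤s z≤n)) 11≤p₁)) c₁ c₂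
    ... | c₀ , c₀≢c₁ , c₀≢c₂ = subst (λ y → 7 ℕ.* p ^ suc (suc m) ℕ.≤ 4 ℕ.* (p ^ suc r ℕ.* y)) (N-aut (tilt c₀) h)
          (case ℕ.<-≤-connex r m of λ { (inj₁ r<m) → low r<m ; (inj₂ m≤r) → high m≤r })
      where
      open ℕ.≤-Reasoning
      h′ = h ∘ to (tilt c₀)
      P = p ^ m
      A = p ^ suc r

      -- Here two points on each slice off zero suffice, since `p ^ (m + 1) ≤ A`.
      high : m ℕ.≤ r → 7 ℕ.* p ^ suc (suc m) ℕ.≤ 4 ℕ.* (A ℕ.* N h′)
      high m≤r = begin
        7 ℕ.* (p ℕ.* (p ℕ.* P)) ≤⟨ parallel-arith (p ℕ.* P) 11≤p₁ ⟩
        4 ℕ.* (p₁ ℕ.* (2 ℕ.* (p ℕ.* P))) ≤⟨ ℕ.*-monoʳ-≤ 4 (ℕ.*-monoʳ-≤ p₁ (ℕ.*-monoʳ-≤ 2 (ℕ.^-monoʳ-≤ p (s≤s m≤r)))) ⟩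
        4 ℕ.* (p₁ ℕ.* (2 ℕ.* A)) ≤⟨ ℕ.*-monoʳ-≤ 4 (N-≥ h′ A (2 ℕ.* A) (λ t → ℕ.≤-trans (ℕ.≤-reflexive (ℕ.*-comm 2 A))
          (ℕ.*-monoʳ-≤ A (two-points c₀ (λ ()) c₁≢c₂ (c₀≢c₁ ∘ sym) (c₀≢c₂ ∘ sym) h₁ h₂)))) ⟩
        4 ℕ.* (A ℕ.* N h′) ∎

      G₀ : V (suc m) → Fin q
      G₀ x = h′ (zero ∷ x)

      G₀0≢0 : G₀ 0v ≢ 0#
      G₀0≢0 e = h0≢0 (trans (cong h (sym (to-0v (tilt c₀)))) e)

      axis-weight : p ℕ.* P ℕ.≤ A ℕ.* count G₀
      axis-weight = ℕ.*-cancelˡ-≤ p (subst (p ℕ.* p ^ suc m ℕ.≤_) (ℕ.*-assoc p A (count G₀))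
        (minWeight (suc m) (Deg-slice zero (Deg-aut (tilt c₀) d)) (count≢0 G₀ 0v G₀0≢0) (suc r) 1 p
          (ℕ.≤-reflexive (ℕ.+-comm 1 _)) (s≤s z≤n) (s≤s z≤n) refl))

      -- `N` omits the origin, which costs one `A`. For `r < m` this is at most `P`, and the term
      -- `4 P` in `crossing-arith` absorbs it.
      low : r ℕ.< m → 7 ℕ.* p ^ suc (suc m) ℕ.≤ 4 ℕ.* (A ℕ.* N h′)
      low r<m = ℕ.+-cancelʳ-≤ (4 ℕ.* P) _ _ (begin
        7 ℕ.* (p ℕ.* (p ℕ.* P)) ℕ.+ 4 ℕ.* P ≤⟨ crossing-arith P 11≤p₁ ⟩
        4 ℕ.* (p ℕ.* P ℕ.+ p₁ ℕ.* (2 ℕ.* (p₁ ℕ.* P))) ≤⟨ ℕ.*-monoʳ-≤ 4 (begin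
          p ℕ.* P ℕ.+ p₁ ℕ.* (2 ℕ.* (p₁ ℕ.* P)) ≤⟨ ℕ.+-mono-≤ axis-weight (ℕ.≤-trans (sum-≥ _ (λ t →
              two-flats c₀ {suc t} (λ ()) c₁≢c₂ (c₀≢c₁ ∘ sym) (c₀≢c₂ ∘ sym) h₁ h₂ {r} d))
              (ℕ.≤-reflexive (sum-*ˡ A (λ t → sliceCount h′ (suc t))))) ⟩
          A ℕ.* count G₀ ℕ.+ A ℕ.* rest ≡⟨ cong (λ y → A ℕ.* y ℕ.+ A ℕ.* rest) (trans (count-N G₀) (cong (ℕ._+ N G₀) (supp-≢0 G₀0≢0))) ⟩
          A ℕ.* suc (N G₀) ℕ.+ A ℕ.* rest ≡⟨ regroup A (N G₀) rest ⟩
          A ℕ.* (N G₀ ℕ.+ rest) ℕ.+ A ≡⟨ cong (λ y → A ℕ.* y ℕ.+ A) (sym (N-suc h′)) ⟩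
          A ℕ.* N h′ ℕ.+ A ≤⟨ ℕ.+-monoʳ-≤ (A ℕ.* N h′) (ℕ.^-monoʳ-≤ p r<m) ⟩
          A ℕ.* N h′ ℕ.+ P ∎) ⟩
        4 ℕ.* (A ℕ.* N h′ ℕ.+ P) ≡⟨ ℕ.*-distribˡ-+ 4 (A ℕ.* N h′) P ⟩
        4 ℕ.* (A ℕ.* N h′) ℕ.+ 4 ℕ.* P ∎)
        where
        rest = sum (λ t → sliceCount h′ (suc t))
        regroup : ∀ A n s → A ℕ.* suc n ℕ.+ A ℕ.* s ≡ A ℕ.* (n ℕ.+ s) ℕ.+ A
        regroup = solve-∀

  hyperplane : ∀ m r {f : V (suc m) → Fin q} → Deg (suc (suc r ℕ.* p₁)) f → Homogeneous f → f 0v ≢ 0# →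
    4 ℕ.* (p ^ suc r ℕ.* N f) ℕ.< 7 ℕ.* p ^ suc m →
    ∃ λ (φ : Aut (suc m)) → ∀ t x → t ≢ zero → f (to φ (t ∷ x)) ≡ 0#
  -- On a line, one nonzero value off the origin forces all `p - 1` of them to be nonzero, which
  -- exceeds the bound.
  hyperplane zero r {f} d hom f0≢0 bound = idᵃ , λ { t [] t≢0 → decidable-stable (_ ≟F _) (λ ne →
      ℕ.<⇒≱ bound (begin
        7 ℕ.* (p ℕ.* 1) ≤⟨ parallel-arith 1 11≤p₁ ⟩
        4 ℕ.* (p₁ ℕ.* 2) ≤⟨ ℕ.*-monoʳ-≤ 4 (ℕ.*-monoʳ-≤ p₁ 2≤A) ⟩
        4 ℕ.* (p₁ ℕ.* A) ≤⟨ ℕ.*-monoʳ-≤ 4 (N-≥ f A A (λ s → ℕ.≤-trans (ℕ.≤-reflexive (sym (ℕ.*-identityʳ A)))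
            (ℕ.*-monoʳ-≤ A (ℕ.n≢0⇒n>0 (slice-homogeneous hom t≢0 (λ ()) (count≢0 (λ x → f (t ∷ x)) [] ne)))))) ⟩
        4 ℕ.* (A ℕ.* N f) ∎)) }
    where
    open ℕ.≤-Reasoning
    A = p ^ suc r
    2≤A : 2 ℕ.≤ A
    2≤A = ℕ.≤-trans (s≤s 1≤p₁) (subst (ℕ._≤ A) (ℕ.*-identityʳ p) (ℕ.*-monoʳ-≤ p (ℕ.m^n>0 p r)))
  hyperplane (suc m) r {f} d hom f0≢0 bound with light-hyperplane (suc m) f
  ... | λs , light with hyperplane m r (Deg-∘ (graph-affine λs) d) (Homogeneous-graph λs hom)
                          (λ e → f0≢0 (trans (cong f (sym (graph-0v λs))) e))
                          (restrict-bound (p ^ suc r) (p ^ suc m) light bound)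
  ...   | φ₂ , φ₂-axis = choose
    where
    -- The shear turns the light hyperplane into the slice zero; `φ₂` then moves the support inside
    -- it to second coordinate zero.
    φ = shearᵃ λs ∘ᵃ liftᵃ φ₂
    h = f ∘ to φ
    h-hom : Homogeneous h
    h-hom = Homogeneous-∘ φ hom
    h-axis : ∀ y z → y ≢ zero → h (zero ∷ y ∷ z) ≡ 0#
    h-axis y z y≢0 = trans (cong (λ t → f (t ∷ to φ₂ (y ∷ z))) (⊕-identityʳ _)) (φ₂-axis y z y≢0)
    conclude : ∀ c₀ → (∀ c → c ≢ c₀ → direction h c ≡ 0) →
      ∃ λ (φ : Aut (suc (suc m))) → ∀ t x → t ≢ zero → f (to φ (t ∷ x)) ≡ 0#
    conclude c₀ other = φ ∘ᵃ tilt h-hom h-axis c₀ , one-direction h-hom h-axis c₀ other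
    choose : ∃ λ (φ : Aut (suc (suc m))) → ∀ t x → t ≢ zero → f (to φ (t ∷ x)) ≡ 0#
    choose with Fin.any? (λ c → ¬? (direction h c ℕ.≟ 0))
    -- No direction is hit, so any `c₀` would do.
    ... | no none = conclude zero (λ c _ → decidable-stable (_ ℕ.≟ 0) (λ ne → none (c , ne)))
    ... | yes (c₁ , h₁) with Fin.any? (λ c → ¬? (c Fin.≟ c₁) ×-dec ¬? (direction h c ℕ.≟ 0))
    ...   | no none = conclude c₁ (λ c c≢c₁ → decidable-stable (_ ℕ.≟ 0) (λ ne → none (c , c≢c₁ , ne)))
    ...   | yes (c₂ , c₂≢c₁ , h₂) = ⊥-elim (ℕ.<⇒≱ bound
              (subst (λ y → 7 ℕ.* p ^ suc (suc m) ℕ.≤ 4 ℕ.* (p ^ suc r ℕ.* y)) (N-aut φ f)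
                (two-directions h-hom h-axis {r} (Deg-aut φ d) (λ e → f0≢0 (trans (cong f (sym (to-0v φ))) e)) (c₂≢c₁ ∘ sym) h₁ h₂)))

  count≤p^m : ∀ {m} (f : V m → Fin q) → count f ℕ.≤ p ^ m
  count≤p^m {m} f = subst (count f ℕ.≤_) (trans (S-const m 1) (ℕ.*-identityʳ _)) (S-mono m (λ x → supp≤1 (f x)))
    where
    supp≤1 : ∀ y → supp y ℕ.≤ 1
    supp≤1 y with y ≟F 0#
    ... | yes e = z≤n
    ... | no _ = ℕ.≤-refl

  -- The support lies in a hyperplane, so the `p - 1` parallel slices are empty and restriction
  -- lowers the degree by `p - 1`: `r` and `m` drop together until only the trivial bound is left.
  flat-weight : ∀ r m {f : V m → Fin q} → r ℕ.≤ m → Deg (suc (r ℕ.* p₁)) f → Homogeneous f → f 0v ≢ 0# →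
    4 ℕ.* (p ^ r ℕ.* N f) ℕ.< 7 ℕ.* p ^ m → p ^ r ℕ.* count f ℕ.≤ p ^ m
  flat-weight zero m {f} _ d hom f0≢0 bound = subst (ℕ._≤ p ^ m) (sym (ℕ.*-identityˡ _)) (count≤p^m f)
  flat-weight (suc r) (suc m) {f} (s≤s r≤m) d hom f0≢0 bound with hyperplane m r d hom f0≢0 bound
  ... | φ , axis = begin
      p ^ suc r ℕ.* count f ≡⟨ cong (p ^ suc r ℕ.*_) (trans (sym (count-aut φ f)) count-g) ⟩
      p ^ suc r ℕ.* count g ≡⟨ ℕ.*-assoc p (p ^ r) (count g) ⟩
      p ℕ.* (p ^ r ℕ.* count g) ≤⟨ ℕ.*-monoʳ-≤ p (flat-weight r m r≤m g-Deg g-hom g0≢0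
          -- One factor of `p ^ suc r` is moved onto `N g`, after which `restrict-bound` applies
          -- with equality.
          (restrict-bound (p ^ r) (p ^ m) {N = p ℕ.* N g} ℕ.≤-refl
            (subst (ℕ._< 7 ℕ.* p ^ suc m) (trans (cong (λ y → 4 ℕ.* (p ^ suc r ℕ.* y)) (trans (sym (N-aut φ f)) N-g))
              (shuffle p (p ^ r) (N g))) bound))) ⟩
      p ^ suc m ∎
    where
    open ℕ.≤-Reasoning
    h = f ∘ to φ
    g : V m → Fin q
    g x = h (zero ∷ x)
    shuffle : ∀ p A n → 4 ℕ.* (p ℕ.* A ℕ.* n) ≡ 4 ℕ.* (A ℕ.* (p ℕ.* n))
    shuffle = solve-∀
    rest≡0 : sum (λ t → sliceCount h (suc t)) ≡ 0
    rest≡0 = trans (sum-cong (λ t → trans (S-cong m (λ x → supp-0 (axis (suc t) x (λ ()))))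
      (trans (S-const m 0) (ℕ.*-zeroʳ (p ^ m))))) (trans (sum-const p₁ 0) (ℕ.*-zeroʳ p₁))
    count-g : count h ≡ count g
    count-g = trans (sum-suc _) (trans (cong (count g ℕ.+_) rest≡0) (ℕ.+-identityʳ _))
    N-g : N h ≡ N g
    N-g = trans (N-suc h) (trans (cong (N g ℕ.+_) rest≡0) (ℕ.+-identityʳ _))
    g0≢0 : g 0v ≢ 0#
    g0≢0 e = f0≢0 (trans (cong f (sym (to-0v φ))) e)
    g-hom : Homogeneous g
    g-hom μ μ≢0 x = trans (cong (λ t → h (t ∷ μ · x)) (sym (⊗-zeroʳ μ))) (Homogeneous-∘ φ hom μ μ≢0 (zero ∷ x))
    L = List.map suc (List.allFin p₁)
    on-L : ∀ {t} → t ∈ L → ∀ x → h (t ∷ x) ≡ 0#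
    on-L t∈L x with ∈-map⁻ suc t∈L
    ... | s , _ , refl = axis (suc s) x (λ ())
    length-L : length L ≡ p₁
    length-L = trans (length-map suc (List.allFin p₁)) (length-tabulate {n = p₁} id)
    degree : suc (suc r ℕ.* p₁) ∸ length L ≡ suc (r ℕ.* p₁)
    degree = trans (cong (suc (suc r ℕ.* p₁) ∸_) length-L)
      (trans (cong (_∸ p₁) (sym (ℕ.+-suc p₁ (r ℕ.* p₁)))) (ℕ.m+n∸m≡n p₁ _))
    g-Deg : Deg (suc (r ℕ.* p₁)) g
    g-Deg = subst (λ n → Deg n g) degree
      (slice-Deg-vanishing L (map⁺ Fin.suc-injective (allFin⁺ p₁)) (Deg-aut φ d) on-L zero)

  -- If `f` is zero at the origin it vanishes altogether, against `N f ≢ 0`; otherwise the origin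
  -- accounts for the successor.
  weight-gap : ∀ r m {f : V m → Fin q} → r ℕ.≤ m → Deg (suc (r ℕ.* p₁)) f → Homogeneous f →
    N f ≢ 0 → 4 ℕ.* (p ^ r ℕ.* N f) ℕ.< 7 ℕ.* p ^ m → p ^ r ℕ.* suc (N f) ℕ.≤ p ^ m
  weight-gap r m {f} r≤m d hom N≢0 bound with f 0v ≟F 0#
  ... | yes e = ⊥-elim (N≢0 (ℕ.m+n≡0⇒n≡0 (supp (f 0v)) (trans (sym (count-N f))
      (trans (S-cong m (λ x → supp-0 (vanishes m r d hom e bound x))) (trans (S-const m 0) (ℕ.*-zeroʳ (p ^ m)))))))
  ... | no f0≢0 = subst (λ y → p ^ r ℕ.* y ℕ.≤ p ^ m) (trans (count-N f) (cong (ℕ._+ N f) (supp-≢0 f0≢0)))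
      (flat-weight r m r≤m d hom f0≢0 bound)

isYes-true : ∀ {A : Set} (a? : Dec A) → A → ⌊ a? ⌋ ≡ true
isYes-true a? a = trans (isYes≗does a?) (dec-true a? a)

isYes-false : ∀ {A : Set} (a? : Dec A) → ¬ A → ⌊ a? ⌋ ≡ false
isYes-false a? ¬a = trans (isYes≗does a?) (dec-false a? ¬a)

-- Linear forms and annihilators of subspaces

module Forms {q : ℕ} (𝔽 : FieldOn q) where
  open FieldProperties 𝔽
  open Geometry 𝔽 hiding (points)

  form : ∀ {N} → Vect N → Vect N → Fin q
  form [] [] = 0#
  form (a ∷ l) (b ∷ x) = a * b + form l x

  form-zeroˡ : ∀ {N} (x : Vect N) → form zeroV x ≡ 0#
  form-zeroˡ [] = refl
  form-zeroˡ (b ∷ x) = trans (cong₂ _+_ (zeroˡ b) (form-zeroˡ x)) (+-identityʳ 0#)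

  form-zeroʳ : ∀ {N} (l : Vect N) → form l zeroV ≡ 0#
  form-zeroʳ [] = refl
  form-zeroʳ (a ∷ l) = trans (cong₂ _+_ (zeroʳ a) (form-zeroʳ l)) (+-identityʳ 0#)

  form-+ˡ : ∀ {N} (l m x : Vect N) → form (l +V m) x ≡ form l x + form m x
  form-+ˡ [] [] [] = sym (+-identityʳ 0#)
  form-+ˡ (a ∷ l) (b ∷ m) (c ∷ x) = trans (cong ((a + b) * c +_) (form-+ˡ l m x))
    (solve 5 (λ a b c L M → (a :+ b) :* c :+ (L :+ M) := a :* c :+ L :+ (b :* c :+ M)) refl a b c (form l x) (form m x))

  form-+ʳ : ∀ {N} (l x y : Vect N) → form l (x +V y) ≡ form l x + form l y
  form-+ʳ [] [] [] = sym (+-identityʳ 0#)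
  form-+ʳ (a ∷ l) (b ∷ x) (c ∷ y) = trans (cong (a * (b + c) +_) (form-+ʳ l x y))
    (solve 5 (λ a b c L M → a :* (b :+ c) :+ (L :+ M) := a :* b :+ L :+ (a :* c :+ M)) refl a b c (form l x) (form l y))

  form-·ˡ : ∀ {N} s (l x : Vect N) → form (s ·V l) x ≡ s * form l x
  form-·ˡ s [] [] = sym (zeroʳ s)
  form-·ˡ s (a ∷ l) (b ∷ x) = trans (cong (s * a * b +_) (form-·ˡ s l x))
    (solve 4 (λ s a b L → s :* a :* b :+ s :* L := s :* (a :* b :+ L)) refl s a b (form l x))

  form-·ʳ : ∀ {N} s (l x : Vect N) → form l (s ·V x) ≡ s * form l x
  form-·ʳ s [] [] = sym (zeroʳ s)
  form-·ʳ s (a ∷ l) (b ∷ x) = trans (cong (a * (s * b) +_) (form-·ʳ s l x))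
    (solve 4 (λ s a b L → a :* (s :* b) :+ s :* L := s :* (a :* b :+ L)) refl s a b (form l x))

  Killed : ∀ {N} → List (Vect N) → Vect N → Set
  Killed ls x = All (λ l → form l x ≡ 0#) ls

  basis : ∀ N → List (Vect N)
  basis zero = []
  basis (suc N) = (1# ∷ zeroV) ∷ List.map (0# ∷_) (basis N)

  length-basis : ∀ N → length (basis N) ≡ N
  length-basis zero = refl
  length-basis (suc N) = cong suc (trans (length-map (0# ∷_) (basis N)) (length-basis N))

  killed-zeroV : ∀ {N} (ls : List (Vect N)) → Killed ls zeroV
  killed-zeroV ls = All.universal (λ l → form-zeroʳ l) ls

  basis-kills : ∀ {N} (x : Vect N) → Killed (basis N) x → x ≡ zeroV
  basis-kills [] _ = refl
  basis-kills (b ∷ x) (e ∷ es) = cong₂ _∷_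
    (trans (sym (trans (cong₂ _+_ (*-identityˡ b) (form-zeroˡ x)) (+-identityʳ b))) e)
    (basis-kills x (All.map (λ {l} e → trans (sym (trans (cong (_+ form l x) (zeroˡ b)) (+-identityˡ _))) e) (All.map⁻ es)))

  ·V-distrib : ∀ {N} t (v x : Vect N) → (t ·V v) +V (x +V ((- t) ·V v)) ≡ x
  ·V-distrib t [] [] = refl
  ·V-distrib t (a ∷ v) (b ∷ x) = cong₂ _∷_ (begin
    t * a + (b + (- t) * a) ≡⟨ cong (λ y → t * a + (b + y)) (sym (-‿distribˡ-* t a)) ⟩
    t * a + (b - t * a) ≡⟨ y+[x-y]≡x b (t * a) ⟩
    b ∎) (·V-distrib t v x)
    where open ≡-Reasoning

  zero·V : ∀ {N} (v : Vect N) → 0# ·V v ≡ zeroV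
  zero·V [] = refl
  zero·V (a ∷ v) = cong₂ _∷_ (zeroˡ a) (zero·V v)

  zeroV+ : ∀ {N} (v : Vect N) → zeroV +V v ≡ v
  zeroV+ [] = refl
  zeroV+ (a ∷ v) = cong₂ _∷_ (+-identityˡ a) (zeroV+ v)

  -1·V+ : ∀ {N} (v : Vect N) → ((- 1#) ·V v) +V v ≡ zeroV
  -1·V+ [] = refl
  -1·V+ (a ∷ v) = cong₂ _∷_ (trans (cong (_+ a) (trans (sym (-‿distribˡ-* 1# a)) (cong -_ (*-identityˡ a)))) (-‿inverseˡ a)) (-1·V+ v)

  LinIndep-tail : ∀ {m N} {v : Vect N} {vs : Vec (Vect N) m} → LinIndep (v ∷ vs) → LinIndep vs
  LinIndep-tail {v = v} {vs} ind cs e =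
    cong Vec.tail (ind (0# ∷ cs) (trans (cong₂ _+V_ (zero·V v) e) (zeroV+ zeroV)))

  LinIndep-head : ∀ {m N} {v : Vect N} {vs : Vec (Vect N) m} → LinIndep (v ∷ vs) → ¬ InSpan v vs
  LinIndep-head {v = v} ind (cs , e) = 0≢1 (trans (sym (-‿inverseʳ 1#)) (trans (cong (1# +_) -1≡0) (+-identityʳ 1#)))
    where
    -1≡0 : - 1# ≡ 0#
    -1≡0 = cong Vec.head (ind ((- 1#) ∷ cs) (trans (cong (((- 1#) ·V v) +V_) e) (-1·V+ v)))

  private
    -- Takes the first element failing `P` out of the list; the two transfer functions for `All`
    -- record that nothing else changes.
    pick : ∀ {A : Set} {P : A → Set} → Decidable P → (ls : List A) → ¬ All P ls →
      ∃ λ l → ∃ λ rest → ¬ P l × length ls ≡ suc (length rest) ×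
        (∀ {Q : A → Set} → All Q ls → Q l × All Q rest) × (∀ {Q : A → Set} → Q l → All Q rest → All Q ls)
    pick P? [] none = ⊥-elim (none [])
    pick P? (l ∷ ls) none with P? l
    ... | no ¬p = l , ls , ¬p , refl , (λ { (a ∷ as) → a , as }) , _∷_
    ... | yes p with pick P? ls (λ all → none (p ∷ all))
    ...   | l′ , rest , ¬p , len , to , from = l′ , l ∷ rest , ¬p , cong suc len
            , (λ { (a ∷ as) → proj₁ (to as) , a ∷ proj₂ (to as) }) , (λ { b (a ∷ as) → a ∷ from b as })

  -- The forms of the span of v ∷ vs come from those of vs by eliminating one form that does not vanish at v.
  annihilator : ∀ {m N} (vs : Vec (Vect N) m) → LinIndep vs →
    ∃ λ ls → length ls ℕ.+ m ≡ N × (∀ x → InSpan x vs → Killed ls x) × (∀ x → Killed ls x → InSpan x vs)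
  annihilator {N = N} [] ind = basis N , trans (ℕ.+-identityʳ _) (length-basis N)
    , (λ { x ([] , refl) → killed-zeroV (basis N) }) , (λ x k → [] , sym (basis-kills x k))
  annihilator {suc m} {N} (v ∷ vs) ind with annihilator vs (LinIndep-tail ind)
  ... | ls , len , to , from with pick (λ l → form l v ≟F 0#) ls (λ k → LinIndep-head ind (from v k))
  ...   | l , rest , lv≢0 , len′ , split , join =
    List.map reduce rest
    , trans (cong (ℕ._+ suc m) (length-map reduce rest))
        (trans (ℕ.+-suc _ m) (trans (cong (ℕ._+ m) (sym len′)) len))
    , (λ { x (t ∷ cs , refl) → All.map⁺ (All.map (λ {l′} → sound t (lincomb cs vs)
          (proj₁ (split (to _ (cs , refl)))) {l′}) (proj₂ (split (to _ (cs , refl))))) })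
    , complete
    where
    open ≡-Reasoning
    -- Chosen so that `reduce l′` vanishes at `v`.
    slope : Vect N → Fin q
    slope l′ = - (form l′ v * inv (form l v))
    reduce : Vect N → Vect N
    reduce l′ = l′ +V (slope l′ ·V l)
    form-reduce : ∀ l′ x → form (reduce l′) x ≡ form l′ x + slope l′ * form l x
    form-reduce l′ x = trans (form-+ˡ l′ _ x) (cong (form l′ x +_) (form-·ˡ (slope l′) l x))
    reduce-v : ∀ l′ → form l′ v + slope l′ * form l v ≡ 0#
    reduce-v l′ = begin
      form l′ v + slope l′ * form l v ≡⟨ cong (form l′ v +_) (sym (-‿distribˡ-* _ _)) ⟩
      form l′ v - form l′ v * inv (form l v) * form l v ≡⟨ cong (λ y → form l′ v - y) (begin
        form l′ v * inv (form l v) * form l v ≡⟨ *-assoc _ _ _ ⟩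
        form l′ v * (inv (form l v) * form l v) ≡⟨ cong (form l′ v *_) (trans (*-comm _ _) (inv-correct _ lv≢0)) ⟩
        form l′ v * 1# ≡⟨ trans (*-comm _ _) (*-identityˡ _) ⟩
        form l′ v ∎) ⟩
      form l′ v - form l′ v ≡⟨ -‿inverseʳ _ ⟩
      0# ∎
    sound : ∀ t y → form l y ≡ 0# → ∀ {l′} → form l′ y ≡ 0# → form (reduce l′) ((t ·V v) +V y) ≡ 0#
    sound t y ly {l′} l′y = begin
      form (reduce l′) ((t ·V v) +V y) ≡⟨ form-+ʳ (reduce l′) (t ·V v) y ⟩
      form (reduce l′) (t ·V v) + form (reduce l′) y ≡⟨ cong₂ _+_ (form-·ʳ t (reduce l′) v) (form-reduce l′ y) ⟩
      t * form (reduce l′) v + (form l′ y + slope l′ * form l y)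
        ≡⟨ cong₂ (λ a b → t * a + b) (trans (form-reduce l′ v) (reduce-v l′))
             (trans (cong₂ (λ a b → a + slope l′ * b) l′y ly) (trans (+-identityˡ _) (zeroʳ _))) ⟩
      t * 0# + 0# ≡⟨ trans (+-identityʳ _) (zeroʳ t) ⟩
      0# ∎
    complete : ∀ x → Killed (List.map reduce rest) x → InSpan x (v ∷ vs)
    complete x k with from y (join ly (All.map (λ {l′} → l′y {l′}) (All.map⁻ k)))
      where
      -- Subtracting this multiple of `v` moves `x` into the kernel of `l`, where `l′` and
      -- `reduce l′` agree.
      t = form l x * inv (form l v)
      y = x +V ((- t) ·V v)
      form-y : ∀ l′ → form l′ y ≡ form l′ x - t * form l′ v
      form-y l′ = trans (form-+ʳ l′ x _) (cong (form l′ x +_) (trans (form-·ʳ (- t) l′ v) (sym (-‿distribˡ-* t _))))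
      ly : form l y ≡ 0#
      ly = trans (form-y l) (trans (cong (λ a → form l x - a) (trans (*-assoc _ _ _)
        (trans (cong (form l x *_) (trans (*-comm _ _) (inv-correct _ lv≢0))) (trans (*-comm _ _) (*-identityˡ _))))) (-‿inverseʳ _))
      l′y : ∀ {l′} → form (reduce l′) x ≡ 0# → form l′ y ≡ 0#
      l′y {l′} e = begin
        form l′ y ≡⟨ form-y l′ ⟩
        form l′ x - t * form l′ v ≡⟨ cong (λ a → form l′ x - a)
          (solve 3 (λ a b c → a :* b :* c := c :* b :* a) refl (form l x) (inv (form l v)) (form l′ v)) ⟩
        form l′ x - form l′ v * inv (form l v) * form l x ≡⟨ cong (form l′ x +_) (-‿distribˡ-* _ _) ⟩
        form l′ x + slope l′ * form l x ≡⟨ sym (form-reduce l′ x) ⟩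
        form (reduce l′) x ≡⟨ e ⟩
        0# ∎
    ... | cs , e = (form l x * inv (form l v) ∷ cs) , trans (cong (((form l x * inv (form l v)) ·V v) +V_) e) (·V-distrib (form l x * inv (form l v)) v x)

  -- Codewords as functions on the vector space

  isZero : Fin q → Fin q
  isZero y = if does (y ≟F 0#) then 1# else 0#

  isZero-0 : ∀ {y} → y ≡ 0# → isZero y ≡ 1#
  isZero-0 {y} e = cong (if_then 1# else 0#) (dec-true (y ≟F 0#) e)

  isZero-≢0 : ∀ {y} → y ≢ 0# → isZero y ≡ 0#
  isZero-≢0 {y} h = cong (if_then 1# else 0#) (dec-false (y ≟F 0#) h)

  indicator : ∀ {N} → List (Vect N) → Vect N → Fin q
  indicator [] x = 1#
  indicator (l ∷ ls) x = isZero (form l x) * indicator ls x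

  indicator-in : ∀ {N} {ls : List (Vect N)} {x} → Killed ls x → indicator ls x ≡ 1#
  indicator-in [] = refl
  indicator-in (e ∷ es) = trans (cong₂ _*_ (isZero-0 e) (indicator-in es)) (*-identityˡ 1#)

  indicator-out : ∀ {N} (ls : List (Vect N)) {x} → ¬ Killed ls x → indicator ls x ≡ 0#
  indicator-out [] h = ⊥-elim (h [])
  indicator-out (l ∷ ls) {x} h with form l x ≟F 0#
  ... | yes e = trans (*-identityˡ _) (indicator-out ls (λ k → h (e ∷ k)))
  ... | no _ = zeroˡ _

  isZero-· : ∀ {μ} → μ ≢ 0# → ∀ y → isZero (μ * y) ≡ isZero y
  isZero-· {μ} μ≢0 y with y ≟F 0#
  ... | yes e = isZero-0 (trans (cong (μ *_) e) (zeroʳ μ))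
  ... | no ne = isZero-≢0 (*-≢0 μ≢0 ne)

  indicator-· : ∀ {N μ} → μ ≢ 0# → ∀ (ls : List (Vect N)) x → indicator ls (μ ·V x) ≡ indicator ls x
  indicator-· μ≢0 [] x = refl
  indicator-· {μ = μ} μ≢0 (l ∷ ls) x = cong₂ _*_
    (trans (cong isZero (form-·ʳ μ l x)) (isZero-· μ≢0 (form l x))) (indicator-· μ≢0 ls x)

  forms : ∀ {n k} → Subspace n k → List (Vect (suc n))
  forms (vs , ind) = proj₁ (annihilator vs ind)

  length-forms : ∀ {n k} (U : Subspace n k) → length (forms U) ℕ.+ suc k ≡ suc n
  length-forms (vs , ind) = proj₁ (proj₂ (annihilator vs ind))

  -- Lifts the codeword to all vectors, with values in the field; at the zero vector every subspace
  -- contributes its coefficient.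
  word : ∀ {n k} → Combination n k → Vect (suc n) → Fin q
  word [] x = 0#
  word ((a , U) ∷ L) x = a ×ℕ 1# * indicator (forms U) x + word L x

  word-value : ∀ {n k x r} {L : Combination n k} → ValueAt x L r → r ×ℕ 1# ≡ word L x
  word-value v-nil = refl
  word-value {x = x} (v-in {a} {U} {L} {r} i V) = trans (×ℕ-homo-+ 1# a r) (cong₂ _+_
    (trans (sym (trans (*-comm _ _) (*-identityˡ _))) (cong (a ×ℕ 1# *_)
      (sym (indicator-in (proj₁ (proj₂ (proj₂ (annihilator (proj₁ U) (proj₂ U)))) x i))))) (word-value V))
  word-value {x = x} (v-out {a} {U} {L} {r} i V) = trans (word-value V)
    (sym (trans (cong (λ y → a ×ℕ 1# * y + word L x) (indicator-out (forms U)
      (λ k → i (proj₂ (proj₂ (proj₂ (annihilator (proj₁ U) (proj₂ U)))) x k)))) (trans (cong (_+ word L x) (zeroʳ _)) (+-identityˡ _))))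

  word-· : ∀ {n k μ} → μ ≢ 0# → ∀ (L : Combination n k) x → word L (μ ·V x) ≡ word L x
  word-· μ≢0 [] x = refl
  word-· μ≢0 ((a , U) ∷ L) x = cong₂ (λ y z → a ×ℕ 1# * y + z) (indicator-· μ≢0 (forms U) x) (word-· μ≢0 L x)

  -- Counting projective points

  SF : ∀ N → (Vect N → ℕ) → ℕ
  SF zero w = w []
  SF (suc N) w = sum (λ a → SF N (λ v → w (a ∷ v)))

  SF-cong : ∀ N {v w : Vect N → ℕ} → (∀ x → v x ≡ w x) → SF N v ≡ SF N w
  SF-cong zero h = h []
  SF-cong (suc N) h = sum-cong (λ a → SF-cong N (λ v → h (a ∷ v)))

  SF-0 : ∀ N → SF N (λ _ → 0) ≡ 0
  SF-0 zero = refl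
  SF-0 (suc N) = trans (sum-cong (λ _ → SF-0 N)) (trans (sum-const q 0) (ℕ.*-zeroʳ q))

  SF-· : ∀ N {μ} → μ ≢ 0# → (w : Vect N → ℕ) → SF N (λ v → w (μ ·V v)) ≡ SF N w
  SF-· zero μ≢0 w = refl
  SF-· (suc N) {μ} μ≢0 w = trans (sum-cong (λ a → SF-· N μ≢0 (λ v → w (μ * a ∷ v))))
    (sum-injective (*-cancelˡ μ μ≢0) (λ a → SF N (λ v → w (a ∷ v))))

  normalized : ∀ {N} → (Vect N → ℕ) → Vect N → ℕ
  normalized g v = if isNormalized v then g v else 0

  -- A point has `q - 1` nonzero multiples, and subtraction is avoided by adding the normalized sum
  -- on the left. In the induction the slices with nonzero first coordinate all have the same sum,
  -- and just the one at `1#` consists of normalized vectors.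
  SF-normalized : ∀ N (g : Vect N → ℕ) → (∀ μ → μ ≢ 0# → ∀ v → g (μ ·V v) ≡ g v) →
    SF N g ℕ.+ SF N (normalized g) ≡ g zeroV ℕ.+ q ℕ.* SF N (normalized g)
  SF-normalized zero g hom = cong (g [] ℕ.+_) (sym (ℕ.*-zeroʳ q))
  SF-normalized (suc N) g hom = begin
    sum G ℕ.+ SF (suc N) (normalized g) ≡⟨ cong (sum G ℕ.+_) W≡ ⟩
    sum G ℕ.+ (W₀ ℕ.+ G 1#) ≡⟨ trans (cong (sum G ℕ.+_) (ℕ.+-comm W₀ _)) (sym (ℕ.+-assoc (sum G) (G 1#) W₀)) ⟩
    sum G ℕ.+ G 1# ℕ.+ W₀ ≡⟨ cong (ℕ._+ W₀) (sum-except G 0# (G 1#) G-const) ⟩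
    G 0# ℕ.+ q ℕ.* G 1# ℕ.+ W₀ ≡⟨ trans (ℕ.+-assoc (G 0#) _ W₀) (trans (cong (G 0# ℕ.+_) (ℕ.+-comm _ W₀)) (sym (ℕ.+-assoc (G 0#) W₀ _))) ⟩
    G 0# ℕ.+ W₀ ℕ.+ q ℕ.* G 1# ≡⟨ cong (ℕ._+ q ℕ.* G 1#) (SF-normalized N (λ v → g (0# ∷ v))
         (λ μ μ≢0 v → trans (cong (λ a → g (a ∷ μ ·V v)) (sym (zeroʳ μ))) (hom μ μ≢0 (0# ∷ v)))) ⟩
    g zeroV ℕ.+ q ℕ.* W₀ ℕ.+ q ℕ.* G 1# ≡⟨ trans (ℕ.+-assoc (g zeroV) _ _) (cong (g zeroV ℕ.+_) (sym (ℕ.*-distribˡ-+ q W₀ (G 1#)))) ⟩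
    g zeroV ℕ.+ q ℕ.* (W₀ ℕ.+ G 1#) ≡⟨ cong (λ y → g zeroV ℕ.+ q ℕ.* y) (sym W≡) ⟩
    g zeroV ℕ.+ q ℕ.* SF (suc N) (normalized g) ∎
    where
    open ≡-Reasoning
    G : Fin q → ℕ
    G a = SF N (λ v → g (a ∷ v))
    W₀ = SF N (normalized (λ v → g (0# ∷ v)))
    G-const : ∀ a → a ≢ 0# → G a ≡ G 1#
    G-const a a≢0 = trans (sym (SF-· N a≢0 (λ v → g (a ∷ v)))) (SF-cong N (λ v →
      trans (cong (λ b → g (b ∷ a ·V v)) (sym (trans (*-comm a 1#) (*-identityˡ a)))) (hom a a≢0 (1# ∷ v))))
    norm-0 : ∀ v → normalized g (0# ∷ v) ≡ normalized (λ v → g (0# ∷ v)) v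
    norm-0 v = cong (λ b → if (if b then isNormalized v else ⌊ 0# ≟F 1# ⌋) then g (0# ∷ v) else 0) (isYes-true (0# ≟F 0#) refl)
    norm-1 : ∀ v → normalized g (1# ∷ v) ≡ g (1# ∷ v)
    norm-1 v = cong₂ (λ b c → if (if b then isNormalized v else c) then g (1# ∷ v) else 0)
      (isYes-false (1# ≟F 0#) (0≢1 ∘ sym)) (isYes-true (1# ≟F 1#) refl)
    norm-other : ∀ a → a ≢ 0# → a ≢ 1# → ∀ v → normalized g (a ∷ v) ≡ 0
    norm-other a a≢0 a≢1 v = cong₂ (λ b c → if (if b then isNormalized v else c) then g (a ∷ v) else 0)
      (isYes-false (a ≟F 0#) a≢0) (isYes-false (a ≟F 1#) a≢1)
    W≡ : SF (suc N) (normalized g) ≡ W₀ ℕ.+ G 1#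
    W≡ = trans (sum-supported _ 0# 1# 0≢1 (λ a a≢0 a≢1 → trans (SF-cong N (norm-other a a≢0 a≢1)) (SF-0 N)))
      (cong₂ ℕ._+_ (SF-cong N norm-0) (SF-cong N norm-1))

  length-filterᵇ : ∀ N (P : Vect N → Bool) → length (filterᵇ P (allVects N)) ≡ SF N (λ v → if P v then 1 else 0)
  length-filterᵇ zero P with P []
  ... | true = refl
  ... | false = refl
  length-filterᵇ (suc N) P = trans (rows id) (sum-cong (λ a → length-filterᵇ N (λ v → P (a ∷ v))))
    where
    filterᵇ-++ : ∀ {A : Set} (P : A → Bool) xs ys → length (filterᵇ P (xs List.++ ys)) ≡ length (filterᵇ P xs) ℕ.+ length (filterᵇ P ys)
    filterᵇ-++ P [] ys = refl
    filterᵇ-++ P (x ∷ xs) ys with P x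
    ... | true = cong suc (filterᵇ-++ P xs ys)
    ... | false = filterᵇ-++ P xs ys
    filterᵇ-map : ∀ {A B : Set} (P : B → Bool) (f : A → B) xs → length (filterᵇ P (List.map f xs)) ≡ length (filterᵇ (P ∘ f) xs)
    filterᵇ-map P f [] = refl
    filterᵇ-map P f (x ∷ xs) with P (f x)
    ... | true = cong suc (filterᵇ-map P f xs)
    ... | false = filterᵇ-map P f xs
    -- Generalized from `allFin q` to any tabulated family, so that induction on the length works.
    rows : ∀ {n} (f : Fin n → Fin q) → length (filterᵇ P (List.concatMap (λ a → List.map (a ∷_) (allVects N)) (List.tabulate f))) ≡
      sum (λ i → length (filterᵇ (λ v → P (f i ∷ v)) (allVects N)))
    rows {zero} f = sym (sum-zero _)
    rows {suc n} f = trans (filterᵇ-++ P (List.map (f zero ∷_) (allVects N)) _)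
      (trans (cong₂ ℕ._+_ (filterᵇ-map P (f zero ∷_) (allVects N)) (rows (f ∘ suc))) (sym (sum-suc _)))

  length-filterᵇ² : ∀ {A : Set} (P R : A → Bool) (xs : List A) → length (filterᵇ P (filterᵇ R xs)) ≡
    length (filterᵇ (λ x → if R x then P x else false) xs)
  length-filterᵇ² P R [] = refl
  length-filterᵇ² P R (x ∷ xs) with R x
  ... | false = length-filterᵇ² P R xs
  ... | true with P x
  ...   | true = cong suc (length-filterᵇ² P R xs)
  ...   | false = length-filterᵇ² P R xs

-- Restriction of scalars to the prime subfield

module Codewords (p₁ : ℕ) (p-prime : Prime (suc p₁)) (11≤p₁ : 11 ℕ.≤ p₁) {q : ℕ} (q≡pp : q ≡ suc p₁ ℕ.* suc p₁)
           (𝔽 : FieldOn q) where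
  open Gap p₁ p-prime 11≤p₁ q≡pp 𝔽
  open Geometry 𝔽 hiding (points)
  open Forms 𝔽

  -- Identifies a K-space of dimension `2 N` with `Vect N`. The order in `N * 2` lets `suc N * 2`
  -- compute to two further coordinates.
  unfold : ∀ {N} → V (N ℕ.* 2) → Vect N
  unfold {zero} [] = []
  unfold {suc N} (x ∷ y ∷ z) = pair x y ∷ unfold z

  S-unfold : ∀ N (w : Vect N → ℕ) → S (N ℕ.* 2) (w ∘ unfold) ≡ SF N w
  S-unfold zero w = refl
  S-unfold (suc N) w = trans (sum-cong (λ x → sum-cong (λ y → S-unfold N (λ v → w (pair x y ∷ v)))))
    (sum-pair (λ a → SF N (λ v → w (a ∷ v))))

  pair-0 : pair zero zero ≡ 0#
  pair-0 = trans (cong (λ a → a + a * ω) ι-zero) (trans (+-identityˡ _) (zeroˡ ω))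

  unfold-0v : ∀ N → unfold {N} 0v ≡ zeroV
  unfold-0v zero = refl
  unfold-0v (suc N) = cong₂ _∷_ pair-0 (unfold-0v N)

  unfold-· : ∀ {N} μ (z : V (N ℕ.* 2)) → unfold {N} (μ · z) ≡ ι μ ·V unfold z
  unfold-· {zero} μ [] = refl
  unfold-· {suc N} μ (x ∷ y ∷ z) = cong₂ _∷_
    (trans (cong₂ (λ a b → a + b * ω) (ι-⊗ μ x) (ι-⊗ μ y))
      (solve 4 (λ m a b w → m :* a :+ m :* b :* w := m :* (a :+ b :* w)) refl (ι μ) (ι x) (ι y) ω))
    (unfold-· μ z)

  pair-⊕ : ∀ a b c d → pair (a ⊕ c) (b ⊕ d) ≡ pair a b + pair c d
  pair-⊕ a b c d = trans (cong₂ (λ x y → x + y * ω) (ι-⊕ a c) (ι-⊕ b d))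
    (solve 5 (λ a b c d w → a :+ c :+ (b :+ d) :* w := a :+ b :* w :+ (c :+ d :* w)) refl (ι a) (ι b) (ι c) (ι d) ω)

  pair-⊗ : ∀ a b x → pair (a ⊗ x) (b ⊗ x) ≡ pair a b * ι x
  pair-⊗ a b x = trans (cong₂ (λ u v → u + v * ω) (ι-⊗ a x) (ι-⊗ b x))
    (solve 4 (λ a b x w → a :* x :+ b :* x :* w := (a :+ b :* w) :* x) refl (ι a) (ι b) (ι x) ω)

  -- In the basis `1, ω` a form over the field becomes two forms over K; their coefficients at `x`
  -- and `y` are the coordinates of `c` and of `c * ω`.
  form-unfold : ∀ {N} (l : Vect N) → ∃ λ A → ∃ λ B → ∀ z → form l (unfold z) ≡ pair (dot A z) (dot B z)
  form-unfold [] = [] , [] , λ { [] → sym pair-0 }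
  form-unfold (c ∷ l) with pair-surjective c | pair-surjective (c * ω) | form-unfold l
  ... | a₁ , a₂ , ea | b₁ , b₂ , eb | A , B , e = (a₁ ∷ b₁ ∷ A) , (a₂ ∷ b₂ ∷ B) , λ { (x ∷ y ∷ z) → begin
      c * pair x y + form l (unfold z) ≡⟨ cong₂ _+_
        (solve 4 (λ c x y w → c :* (x :+ y :* w) := c :* x :+ c :* w :* y) refl c (ι x) (ι y) ω) (e z) ⟩
      c * ι x + c * ω * ι y + pair (dot A z) (dot B z) ≡⟨ trans (+-assoc _ _ _)
        (cong₂ (λ u v → u * ι x + (v * ι y + pair (dot A z) (dot B z))) (sym ea) (sym eb)) ⟩
      pair a₁ a₂ * ι x + (pair b₁ b₂ * ι y + pair (dot A z) (dot B z))
        ≡⟨ cong₂ (λ u v → u + (v + pair (dot A z) (dot B z))) (sym (pair-⊗ a₁ a₂ x)) (sym (pair-⊗ b₁ b₂ y)) ⟩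
      pair (a₁ ⊗ x) (a₂ ⊗ x) + (pair (b₁ ⊗ y) (b₂ ⊗ y) + pair (dot A z) (dot B z))
        ≡⟨ cong (pair (a₁ ⊗ x) (a₂ ⊗ x) +_) (sym (pair-⊕ (b₁ ⊗ y) (b₂ ⊗ y) (dot A z) (dot B z))) ⟩
      pair (a₁ ⊗ x) (a₂ ⊗ x) + pair (b₁ ⊗ y ⊕ dot A z) (b₂ ⊗ y ⊕ dot B z)
        ≡⟨ sym (pair-⊕ (a₁ ⊗ x) (a₂ ⊗ x) (b₁ ⊗ y ⊕ dot A z) (b₂ ⊗ y ⊕ dot B z)) ⟩
      pair (a₁ ⊗ x ⊕ (b₁ ⊗ y ⊕ dot A z)) (a₂ ⊗ x ⊕ (b₂ ⊗ y ⊕ dot B z)) ∎ }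
    where open ≡-Reasoning

  ∏roots-∈ : ∀ {L t} → t ∈ L → ∏roots L t ≡ 0#
  ∏roots-∈ {L = z ∷ L} (here refl) = trans (cong (_* ∏roots L z) (-‿inverseʳ (ι z))) (zeroˡ _)
  ∏roots-∈ {L = z ∷ L} {t} (there t∈L) = trans (cong ((ι t - ι z) *_) (∏roots-∈ t∈L)) (zeroʳ _)

  ∏roots-∉ : ∀ L {t} → t ∉ L → ∏roots L t ≢ 0#
  ∏roots-∉ [] _ e = 0≢1 (sym e)
  ∏roots-∉ (z ∷ L) t∉L = *-≢0 (λ e → t∉L (here (ι-injective (x-y≡0⇒x≡y e)))) (∏roots-∉ L (t∉L ∘ there))

  Deg-∏roots : ∀ {m n g} {U : V m → K} (L : List K) → Affine (ι ∘ U) → Deg n g →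
    Deg (length L ℕ.+ n) (λ x → ∏roots L (U x) * g x)
  Deg-∏roots [] aff d = Deg-resp (λ x → *-identityˡ _) d
  Deg-∏roots (z ∷ L) aff d = mul (add aff (const (- ι z) (λ _ → refl)) (λ _ → refl)) (Deg-∏roots L aff d) (λ x → *-assoc _ _ _)

  nonzeros : List K
  nonzeros = List.map suc (List.allFin p₁)

  length-nonzeros : length nonzeros ≡ p₁
  length-nonzeros = trans (length-map suc (List.allFin p₁)) (length-tabulate {n = p₁} id)

  -- Vanishes exactly on the nonzero elements of K, hence proportional to 1 - t^(p-1) on K.
  δ : K → Fin q
  δ = ∏roots nonzeros

  δ-suc : ∀ t → δ (suc t) ≡ 0#
  δ-suc t = ∏roots-∈ (∈-map⁺ suc (∈-allFin t))

  δ-zero : δ zero ≢ 0#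
  δ-zero = ∏roots-∉ nonzeros (λ z∈ → case ∈-map⁻ suc z∈ of λ { (_ , _ , ()) })

  -- An element is zero exactly if both coordinates are, which `δ u * δ v` detects up to the
  -- constant `δ zero` squared. The factor `y` matches the recursion of `indicator`.
  isZero-pair : ∀ u v y → isZero (pair u v) * y ≡ inv (δ zero) * inv (δ zero) * (δ u * (δ v * y))
  isZero-pair zero zero y = begin
    isZero (pair zero zero) * y ≡⟨ trans (cong (_* y) (isZero-0 pair-0)) (*-identityˡ y) ⟩
    y ≡⟨ sym (trans (cong₂ (λ a b → a * b * y) cancel cancel) (trans (cong (_* y) (*-identityˡ 1#)) (*-identityˡ y))) ⟩
    δ zero * inv (δ zero) * (δ zero * inv (δ zero)) * y
      ≡⟨ solve 3 (λ d i y → d :* i :* (d :* i) :* y := i :* i :* (d :* (d :* y))) refl (δ zero) (inv (δ zero)) y ⟩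
    inv (δ zero) * inv (δ zero) * (δ zero * (δ zero * y)) ∎
    where
    open ≡-Reasoning
    cancel : δ zero * inv (δ zero) ≡ 1#
    cancel = inv-correct (δ zero) δ-zero
  isZero-pair (suc u) v y = trans (cong (_* y) (isZero-≢0 (λ e → case proj₁ (pair≡0 {suc u} {v} e) of λ ())))
    (trans (zeroˡ y) (sym (trans (cong (inv (δ zero) * inv (δ zero) *_) (trans (cong (_* (δ v * y)) (δ-suc u)) (zeroˡ _))) (zeroʳ _))))
  isZero-pair zero (suc v) y = trans (cong (_* y) (isZero-≢0 (λ e → case proj₂ (pair≡0 {zero} {suc v} e) of λ ())))
    (trans (zeroˡ y) (sym (trans (cong (inv (δ zero) * inv (δ zero) *_)
      (trans (cong (δ zero *_) (trans (cong (_* y) (δ-suc v)) (zeroˡ _))) (zeroʳ _))) (zeroʳ _))))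

  -- Every form splits into two K-forms, and testing each of these for zero costs degree `p - 1`.
  Deg-indicator : ∀ {N} (ls : List (Vect N)) → Deg (suc (length ls ℕ.* 2 ℕ.* p₁)) (indicator ls ∘ unfold)
  Deg-indicator [] = const 1# (λ _ → refl)
  Deg-indicator (l ∷ ls) with form-unfold l
  ... | A , B , e = subst (λ n → Deg n (indicator (l ∷ ls) ∘ unfold)) degree
      (Deg-resp (λ z → trans (cong (λ y → isZero y * indicator ls (unfold z)) (e z)) (isZero-pair (dot A z) (dot B z) _))
        (Deg-scale (inv (δ zero) * inv (δ zero))
          (Deg-∏roots nonzeros (dot-affine A) (Deg-∏roots nonzeros (dot-affine B) (Deg-indicator ls)))))
    where
    regroup : ∀ P A → P ℕ.+ (P ℕ.+ suc A) ≡ suc (P ℕ.+ (P ℕ.+ A))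
    regroup = solve-∀
    degree : length nonzeros ℕ.+ (length nonzeros ℕ.+ suc (length ls ℕ.* 2 ℕ.* p₁)) ≡ suc (length (l ∷ ls) ℕ.* 2 ℕ.* p₁)
    degree = trans (cong (λ P → P ℕ.+ (P ℕ.+ suc (length ls ℕ.* 2 ℕ.* p₁))) length-nonzeros) (regroup p₁ _)

  Deg-word : ∀ {n k} (L : Combination n k) → Deg (suc ((n ∸ k) ℕ.* 2 ℕ.* p₁)) (word L ∘ unfold)
  Deg-word [] = zero (λ _ → refl)
  Deg-word {n} {k} ((a , U) ∷ L) = add (Deg-scale (a ×ℕ 1#) (subst (λ r → Deg (suc (r ℕ.* 2 ℕ.* p₁)) (indicator (forms U) ∘ unfold))
      codim (Deg-indicator (forms U)))) (Deg-word L) (λ _ → refl)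
    where
    codim : length (forms U) ≡ n ∸ k
    codim = trans (sym (ℕ.m+n∸n≡m _ (suc k))) (cong (_∸ suc k) (length-forms U))

  word-homogeneous : ∀ {n k} (L : Combination n k) → Homogeneous (word L ∘ unfold)
  word-homogeneous L μ μ≢0 z = trans (cong (word L) (unfold-· μ z)) (word-· (ι-≢0 μ≢0) L (unfold z))

  -- Weights of codewords and their translation into point counts

  weight-SF : ∀ {n k} (L : Combination n k) (c : Vect (suc n) → ℕ) → Represents p c L →
    weight p c ≡ SF (suc n) (normalized (λ v → supp (word L v)))
  weight-SF {n} L c rep = trans (length-filterᵇ² _ isNormalized (allVects (suc n)))
    (trans (length-filterᵇ (suc n) _) (SF-cong (suc n) pointwise))
    where
    nonzero-value : ∀ v → isNormalized v ≡ true → (if not ⌊ p ∣? c v ⌋ then 1 else 0) ≡ supp (word L v)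
    nonzero-value v nv with p ∣? c v
    ... | yes p∣c = sym (supp-0 (trans (sym (word-value (rep v nv))) (p∣⇒×1≡0 p∣c)))
    ... | no p∤c = sym (supp-≢0 (λ e → p∤c (×1≡0⇒p∣ (trans (word-value (rep v nv)) e))))
    pointwise : ∀ v → (if (if isNormalized v then not ⌊ p ∣? c v ⌋ else false) then 1 else 0) ≡ normalized (λ v → supp (word L v)) v
    pointwise v with isNormalized v in eq
    ... | true = nonzero-value v eq
    ... | false = refl

  -- The `q - 1` nonzero multiples of a point share its value; the contribution of the zero vector
  -- cancels, whatever it is.
  N-weight : ∀ {n k} (L : Combination n k) (c : Vect (suc n) → ℕ) → Represents p c L →
    N (word L ∘ unfold) ℕ.+ weight p c ≡ q ℕ.* weight p c
  N-weight {n} L c rep = ℕ.+-cancelˡ-≡ (supp (word L zeroV)) _ _ (begin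
    s₀ ℕ.+ (N f ℕ.+ weight p c) ≡⟨ sym (ℕ.+-assoc s₀ (N f) _) ⟩
    s₀ ℕ.+ N f ℕ.+ weight p c ≡⟨ cong (λ v → supp (word L v) ℕ.+ N f ℕ.+ weight p c) (sym (unfold-0v (suc n))) ⟩
    supp (f 0v) ℕ.+ N f ℕ.+ weight p c ≡⟨ cong (ℕ._+ weight p c) (sym (count-N f)) ⟩
    count f ℕ.+ weight p c ≡⟨ cong₂ ℕ._+_ (S-unfold (suc n) (λ v → supp (word L v))) (weight-SF L c rep) ⟩
    SF (suc n) g ℕ.+ SF (suc n) (normalized g) ≡⟨ SF-normalized (suc n) g (λ μ μ≢0 v → cong supp (word-· μ≢0 L v)) ⟩
    s₀ ℕ.+ q ℕ.* SF (suc n) (normalized g) ≡⟨ cong (λ w → s₀ ℕ.+ q ℕ.* w) (sym (weight-SF L c rep)) ⟩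
    s₀ ℕ.+ q ℕ.* weight p c ∎)
    where
    open ≡-Reasoning
    f = word L ∘ unfold
    g = λ v → supp (word L v)
    s₀ = supp (word L zeroV)

  -- The closed form `(q - 1) θ + 1 = q ^ (k + 1)` without subtraction.
  θ-geometric : ∀ k → q ℕ.* θ q k ℕ.+ 1 ≡ q ^ suc k ℕ.+ θ q k
  θ-geometric zero = refl
  θ-geometric (suc k) = begin
    q ℕ.* (q ^ suc k ℕ.+ θ q k) ℕ.+ 1 ≡⟨ cong (ℕ._+ 1) (ℕ.*-distribˡ-+ q (q ^ suc k) (θ q k)) ⟩
    q ^ suc (suc k) ℕ.+ q ℕ.* θ q k ℕ.+ 1 ≡⟨ ℕ.+-assoc (q ^ suc (suc k)) _ 1 ⟩
    q ^ suc (suc k) ℕ.+ (q ℕ.* θ q k ℕ.+ 1) ≡⟨ cong (q ^ suc (suc k) ℕ.+_) (θ-geometric k) ⟩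
    q ^ suc (suc k) ℕ.+ θ q (suc k) ∎
    where open ≡-Reasoning

  private
    -- The 20 is `4 * 5`, from the error term in the weight bound; in fact `q ≥ 144`.
    20≤q : 20 ℕ.≤ q
    20≤q = ℕ.≤-trans (ℕ.≤-trans (ℕ.m≤m+n 20 124) (ℕ.*-mono-≤ (s≤s 11≤p₁) (s≤s 11≤p₁))) (ℕ.≤-reflexive (sym q≡pp))

    p^[k*2] : ∀ k → p ^ (k ℕ.* 2) ≡ q ^ k
    p^[k*2] zero = refl
    p^[k*2] (suc k) = trans (sym (ℕ.*-assoc p p _)) (cong₂ ℕ._*_ (sym q≡pp) (p^[k*2] k))

    q^≥ : ∀ k → 1 ℕ.≤ k → 20 ℕ.* q ℕ.≤ q ^ suc k
    q^≥ (suc k) _ = ℕ.≤-trans (ℕ.*-monoˡ-≤ q 20≤q) (ℕ.*-monoʳ-≤ q (ℕ.m≤m*n q (q ^ k) ⦃ ℕ.>-nonZero (ℕ.m^n>0 q ⦃ q-nonZero ⦄ k) ⦄))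
      where
      q-nonZero : ℕ.NonZero q
      q-nonZero = ℕ.>-nonZero (ℕ.≤-trans (s≤s z≤n) 20≤q)

  no-weight-between : ∀ n k → k ℕ.≤ n → 1 ℕ.≤ k → (L : Combination n k) (c : Vect (suc n) → ℕ) → Represents p c L →
    ¬ (θ q k ℕ.< weight p c × 7 ℕ.* weight p c ℕ.< 12 ℕ.* θ q k ℕ.+ 6)
  no-weight-between n k k≤n 1≤k L c rep (θ<w , 7w<) = go (ℕ.pred q) (sym (ℕ.suc-pred q ⦃ ℕ.>-nonZero (ℕ.≤-trans (s≤s z≤n) 20≤q) ⦄))
    where
    open ℕ.≤-Reasoning
    f = word L ∘ unfold
    w = weight p c
    T = θ q k
    Q = q ^ suc k
    r = (n ∸ k) ℕ.* 2
    m = suc n ℕ.* 2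
    -- The dimension splits as `r + 2 (k + 1)`, and two K-dimensions account for one factor `q`.
    p^m : p ^ m ≡ p ^ r ℕ.* Q
    p^m = trans (cong (p ^_) (trans (cong (ℕ._* 2) (sym (trans (ℕ.+-suc _ k) (cong suc (ℕ.m∸n+n≡m k≤n))))) (ℕ.*-distribʳ-+ 2 (n ∸ k) (suc k))))
      (trans (ℕ.^-distribˡ-+-* p r (suc k ℕ.* 2)) (cong (p ^ r ℕ.*_) (p^[k*2] (suc k))))
    r≤m : r ℕ.≤ m
    r≤m = ℕ.*-monoˡ-≤ 2 (ℕ.≤-trans (ℕ.m∸n≤m n k) (ℕ.n≤1+n n))
    go : ∀ q′ → q ≡ suc q′ → ⊥
    -- With `q′ = q - 1`, the gap gives `(q - 1) w + 1 ≤ q ^ (k + 1) = (q - 1) θ + 1`, so `w ≤ θ`.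
    go q′ q≡ = ℕ.<⇒≱ θ<w (ℕ.*-cancelˡ-≤ q′ ⦃ ℕ.>-nonZero q′>0 ⦄ (ℕ.s≤s⁻¹ (begin
        suc (q′ ℕ.* w) ≡⟨ cong suc (sym N≡) ⟩
        suc (N f) ≤⟨ ℕ.*-cancelˡ-≤ (p ^ r) ⦃ ℕ.m^n≢0 p r ⦄ (subst (p ^ r ℕ.* suc (N f) ℕ.≤_) p^m
          (weight-gap r m r≤m (Deg-word L) (word-homogeneous L) N≢0 bound)) ⟩
        Q ≡⟨ Q≡ ⟩
        suc (q′ ℕ.* T) ∎)))
      where
      q′>0 : 0 ℕ.< q′
      q′>0 = ℕ.s≤s⁻¹ (ℕ.≤-trans (s≤s (s≤s z≤n)) (subst (20 ℕ.≤_) q≡ 20≤q))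
      N≡ : N f ≡ q′ ℕ.* w
      N≡ = ℕ.+-cancelʳ-≡ w _ _ (trans (N-weight L c rep) (trans (cong (ℕ._* w) q≡) (ℕ.+-comm w _)))
      N≢0 : N f ≢ 0
      N≢0 e = ℕ.<⇒≢ (ℕ.*-mono-< q′>0 (ℕ.≤-<-trans z≤n θ<w)) (sym (trans (sym N≡) e))
      Q≡ : Q ≡ suc (q′ ℕ.* T)
      Q≡ = ℕ.+-cancelʳ-≡ T _ _ (trans (sym (θ-geometric k)) (trans (cong (λ q → q ℕ.* T ℕ.+ 1) q≡) (regroup q′ T)))
        where
        regroup : ∀ a T → suc a ℕ.* T ℕ.+ 1 ≡ suc (a ℕ.* T) ℕ.+ T
        regroup = solve-∀
      4N<7Q : 4 ℕ.* N f ℕ.< 7 ℕ.* Q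
      -- Integrality gives `7 w ≤ 12 θ + 5`, so `28 N ≤ 48 (Q - 1) + 20 (q - 1) < 49 Q`, because
      -- `20 q ≤ Q` for `k ≥ 1`.
      4N<7Q = ℕ.*-cancelˡ-< 7 _ _ (begin-strict
        7 ℕ.* (4 ℕ.* N f) ≡⟨ trans (cong (λ y → 7 ℕ.* (4 ℕ.* y)) N≡) (regroup q′ w) ⟩
        4 ℕ.* q′ ℕ.* (7 ℕ.* w) ≤⟨ ℕ.*-monoʳ-≤ (4 ℕ.* q′) (ℕ.s≤s⁻¹ (subst (7 ℕ.* w ℕ.<_) (ℕ.+-suc _ 5) 7w<)) ⟩
        4 ℕ.* q′ ℕ.* (12 ℕ.* T ℕ.+ 5) ≡⟨ regroup′ q′ T ⟩
        48 ℕ.* (q′ ℕ.* T) ℕ.+ 20 ℕ.* q′ <⟨ ℕ.+-mono-<-≤ (ℕ.*-monoʳ-< 48 (ℕ.≤-reflexive (sym Q≡)))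
          (ℕ.≤-trans (ℕ.*-monoʳ-≤ 20 (subst (q′ ℕ.≤_) (sym q≡) (ℕ.n≤1+n q′))) (q^≥ k 1≤k)) ⟩
        48 ℕ.* Q ℕ.+ Q ≡⟨ regroup″ Q ⟩
        7 ℕ.* (7 ℕ.* Q) ∎)
        where
        regroup : ∀ a w → 7 ℕ.* (4 ℕ.* (a ℕ.* w)) ≡ 4 ℕ.* a ℕ.* (7 ℕ.* w)
        regroup = solve-∀
        regroup′ : ∀ a T → 4 ℕ.* a ℕ.* (12 ℕ.* T ℕ.+ 5) ≡ 48 ℕ.* (a ℕ.* T) ℕ.+ 20 ℕ.* a
        regroup′ = solve-∀
        regroup″ : ∀ Q → 48 ℕ.* Q ℕ.+ Q ≡ 7 ℕ.* (7 ℕ.* Q)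
        regroup″ = solve-∀
      bound : 4 ℕ.* (p ^ r ℕ.* N f) ℕ.< 7 ℕ.* p ^ m
      bound = begin-strict
        4 ℕ.* (p ^ r ℕ.* N f) ≡⟨ swap (p ^ r) 4 (N f) ⟩
        p ^ r ℕ.* (4 ℕ.* N f) <⟨ ℕ.*-monoʳ-< (p ^ r) ⦃ ℕ.m^n≢0 p r ⦄ 4N<7Q ⟩
        p ^ r ℕ.* (7 ℕ.* Q) ≡⟨ sym (swap (p ^ r) 7 Q) ⟩
        7 ℕ.* (p ^ r ℕ.* Q) ≡⟨ cong (7 ℕ.*_) (sym p^m) ⟩
        7 ℕ.* p ^ m ∎
        where
        swap : ∀ A c B → c ℕ.* (A ℕ.* B) ≡ A ℕ.* (c ℕ.* B)
        swap = solve-∀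

open import Data.Nat using (_+_; _*_; _≤_; _<_)

theorem4p16 : (p : ℕ) → Prime p → 11 < p →
    (F : FieldOn (p ^ 2)) →
    (n k : ℕ) → n ≤ 2 * k → k ≤ n ∸ 1 → 1 ≤ n →
    (L : Geometry.Combination F n k) →
    (c : Geometry.Vect F (suc n) → ℕ) → Geometry.Represents F p c L →
    ¬ (θ (p ^ 2) k < Geometry.weight F p c
    × 7 * Geometry.weight F p c < 12 * θ (p ^ 2) k + 6)
theorem4p16 (suc p₁) p-prime (s≤s 11≤p₁) F n k n≤2k k≤n∸1 1≤n =
  -- The power `p ^ 2` computes to `p * (p * 1)`, whence the equation for `q`.
  Codewords.no-weight-between p₁ p-prime 11≤p₁ (cong (suc p₁ *_) (ℕ.*-identityʳ (suc p₁))) F n k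
    (ℕ.≤-trans k≤n∸1 (ℕ.m∸n≤m n 1)) (k>0 k n≤2k)
  where
  -- Positivity of `k` is what makes `q ^ (k + 1)` dominate `20 q`.
  k>0 : ∀ k → n ≤ 2 * k → 1 ≤ k
  k>0 zero n≤0 = ⊥-elim (ℕ.<⇒≱ 1≤n n≤0)
  k>0 (suc k) _ = s≤s z≤n
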